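{- Let $d\ge 1$ and let $\mathbf{s}=(s_1,\ldots,s_d)$ be a sequence of positive integers such that $s_i\le s_{i+1}$ and $0\le s_{i+1}-s_i\le 1$ for all $1\le i\le d-1$. Suppose that $\mathbf{P}_d^{(\mathbf{s})}$ is translation equivalent to a Fano polytope. Then $\mathbf{P}_d^{(\mathbf{s})}$ is reflexive up to translation if and only if for all $1\le i\le d-1$ one has $k_i\mid s_i$ and $k_i\mid s_{i+1}$, where $k_i=(i+1)s_i-i\,s_{i+1}$.
   Context: For a sequence of positive integers $\mathbf{s}=(s_1,\ldots,s_d)$, the $\mathbf{s}$-lecture hall polytope is $\mathbf{P}_d^{(\mathbf{s})}=\{\mathbf{x}\in\mathbb{R}^d : 0\le \frac{x_1}{s_1}\le\frac{x_2}{s_2}\le\cdots\le\frac{x_d}{s_d}\le 1\}$, a $d$-dimensional lattice polytope. A $d$-dimensional lattice polytope $\mathcal{P}\subset\mathbb{R}^d$ is Fano if $(\mathcal{P}\setminus\partial\mathcal{P})\cap\mathbb{Z}^d=\{\mathbf{0}\}$. It is reflexive if it is Fano and its dual polytope $\mathcal{P}^\vee=\{y\in\mathbb{R}^d : \langle x,y\rangle\le 1 \text{ for all } x\in\mathcal{P}\}$ is a lattice polytope. Two lattice polytopes are translation equivalent if one is the translate of the other by a vector in $\mathbb{Z}^d$; "reflexive up to translation" means translation equivalent to a reflexive polytope. -}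

module Defs where

open import Algebra.Apartness.Bundles using (HeytingField; HeytingCommutativeRing)
open import Algebra.Bundles using (CommutativeRing)
import Algebra.Definitions.RawMonoid as RawMonoidDefs
import Algebra.Properties.Ring as RingProperties
open import Data.Fin.Base using (Fin; zero; suc; inject₁; fromℕ; toℕ)
open import Data.Integer.Base as ℤ using (ℤ; +_; -[1+_]; 0ℤ)
open import Data.Nat.Base as ℕ using (ℕ; zero; suc; NonZero)
open import Data.Product.Base using (_×_; _,_; ∃; proj₁)
open import Data.Sum.Base using (_⊎_; inj₁; inj₂)
open import Data.Vec.Functional using (Vector)
open import Function.Base using (_∘_)
open import Function.Bundles using (_⇔_)
open import Level using (Level; _⊔_) renaming (suc to lsuc)
open import Relation.Binary.Core using (Rel)
open import Relation.Binary.PropositionalEquality.Core using (_≡_)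
open import Relation.Binary.Structures using (IsStrictPartialOrder)
open import Relation.Nullary.Negation.Core using (¬_; contradiction)
open import Relation.Unary using (Pred; _∈_; _≐_)

private
  variable
    ℓ : Level
    d m : ℕ

-- The library has no type of real numbers, so the geometry below is
-- parametrised by an ordered field, of which ℝ is the intended instance.
-- The axioms are the constructive ones: the apartness is the symmetrisation
-- of the strict order (which is hence cotransitive), and decidability of the
-- order is not required.

record OrderedField c ℓ₁ ℓ₂ ℓ₃ : Set (lsuc (c ⊔ ℓ₁ ⊔ ℓ₂ ⊔ ℓ₃)) where
  field
    heytingField : HeytingField c ℓ₁ ℓ₂

  open HeytingField heytingField public

  infix 4 _<_ _≤_

  field
    _<_                  : Rel Carrier ℓ₃
    isStrictPartialOrder : IsStrictPartialOrder _≈_ _<_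
    <⇒#                  : ∀ {x y} → x < y → x # y
    #⇒<⊎>                : ∀ {x y} → x # y → x < y ⊎ y < x
    +-monoʳ-<            : ∀ x {y z} → y < z → x + y < x + z
    *-positive           : ∀ {x y} → 0# < x → 0# < y → 0# < x * y

  open IsStrictPartialOrder isStrictPartialOrder public
    using (<-respˡ-≈; <-respʳ-≈)
    renaming (irrefl to <-irrefl; trans to <-trans)

  _≤_ : Rel Carrier ℓ₃
  x ≤ y = ¬ (y < x)

  commutativeRing : CommutativeRing c ℓ₁
  commutativeRing = HeytingCommutativeRing.commutativeRing heytingCommutativeRing

module Geometry {c ℓ₁ ℓ₂ ℓ₃} (K : OrderedField c ℓ₁ ℓ₂ ℓ₃) where

  open OrderedField K hiding (zero)
  open CommutativeRing commutativeRing using (ring; +-rawMonoid)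
  open RingProperties ring using (-1*x≈-x; -‿involutive; -0#≈0#)
  open RawMonoidDefs +-rawMonoid public using (sum) renaming (_×_ to _·_)

  0<1 : 0# < 1#
  0<1 with #⇒<⊎> (invertible⇒# {1#} {0#} (1# , inverseˡ , inverseʳ))
    where
    1-0≈1 : 1# - 0# ≈ 1#
    1-0≈1 = trans (+-congˡ -0#≈0#) (+-identityʳ 1#)
    inverseˡ : 1# * (1# - 0#) ≈ 1#
    inverseˡ = trans (*-identityˡ _) 1-0≈1
    inverseʳ : (1# - 0#) * 1# ≈ 1#
    inverseʳ = trans (*-identityʳ _) 1-0≈1
  ... | inj₂ 0<1 = 0<1
  ... | inj₁ 1<0 = <-respʳ-≈ (trans (-1*x≈-x (- 1#)) (-‿involutive 1#)) (*-positive 0<-1 0<-1)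
    where
    0<-1 : 0# < - 1#
    0<-1 = <-respˡ-≈ (-‿inverseˡ 1#) (<-respʳ-≈ (+-identityʳ (- 1#)) (+-monoʳ-< (- 1#) 1<0))

  fromℕᴷ : ℕ → Carrier
  fromℕᴷ n = n · 1#

  0<fromℕᴷ : ∀ n → .{{NonZero n}} → 0# < fromℕᴷ n
  0<fromℕᴷ (suc zero)    = <-respʳ-≈ (sym (+-identityʳ 1#)) 0<1
  0<fromℕᴷ (suc (suc n)) =
    <-trans 0<1 (<-respˡ-≈ (+-identityʳ 1#) (+-monoʳ-< 1# (0<fromℕᴷ (suc n))))

  fromℤᴷ : ℤ → Carrier
  fromℤᴷ (+ n)    = fromℕᴷ n
  fromℤᴷ -[1+ n ] = - fromℕᴷ (suc n)

  -- #⇒invertible inverts the difference fromℕᴷ n - 0#.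
  recip : ∀ n → .{{NonZero n}} → Carrier
  recip n = proj₁ (#⇒invertible (#-sym (<⇒# (0<fromℕᴷ n))))

  infixl 7 _/_
  _/_ : Carrier → (n : ℕ) → .{{NonZero n}} → Carrier
  x / n = x * recip n

  Point : ℕ → Set c
  Point d = Vector Carrier d

  latticePoint : Vector ℤ d → Point d
  latticePoint z = fromℤᴷ ∘ z

  ⟨_,_⟩ : Point d → Point d → Carrier
  ⟨ x , y ⟩ = sum (λ j → x j * y j)

  IsAffineCombination : (Fin m → Point d) → Vector Carrier m → Point d → Set ℓ₁
  IsAffineCombination p μ x =
    sum μ ≈ 1# × (∀ j → x j ≈ sum (λ i → μ i * p i j))

  ConvexHull : (Fin m → Point d) → Pred (Point d) (c ⊔ ℓ₁ ⊔ ℓ₃)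
  ConvexHull p x = ∃ λ μ → (∀ i → 0# ≤ μ i) × IsAffineCombination p μ x

  IsLatticePolytope : Pred (Point d) ℓ → Set (c ⊔ ℓ₁ ⊔ ℓ₃ ⊔ ℓ)
  IsLatticePolytope {d = d} P =
    ∃ λ m → ∃ λ (v : Fin m → Vector ℤ d) → P ≐ ConvexHull (latticePoint ∘ v)

  -- dim P = d: the affine hull of P is the whole of d-space.
  IsFullDimensional : Pred (Point d) ℓ → Set (c ⊔ ℓ₁ ⊔ ℓ)
  IsFullDimensional {d = d} P = ∀ x → ∃ λ m → ∃ λ (p : Fin m → Point d) → ∃ λ μ →
    (∀ i → p i ∈ P) × IsAffineCombination p μ x

  -- P ∖ ∂P is the topological interior; the basic neighbourhoods are open cubes.
  Interior : Pred (Point d) ℓ → Pred (Point d) (c ⊔ ℓ₃ ⊔ ℓ)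
  Interior P x = ∃ λ ε → 0# < ε ×
    (∀ y → (∀ j → x j - ε < y j × y j < x j + ε) → y ∈ P)

  Dual : Pred (Point d) ℓ → Pred (Point d) (c ⊔ ℓ₃ ⊔ ℓ)
  Dual P y = ∀ x → x ∈ P → ⟨ x , y ⟩ ≤ 1#

  IsFano : Pred (Point d) ℓ → Set (c ⊔ ℓ₁ ⊔ ℓ₃ ⊔ ℓ)
  IsFano {d = d} P = IsLatticePolytope P × IsFullDimensional P ×
    (∀ (z : Vector ℤ d) → latticePoint z ∈ Interior P ⇔ (∀ j → z j ≡ 0ℤ))

  IsReflexive : Pred (Point d) ℓ → Set (c ⊔ ℓ₁ ⊔ ℓ₃ ⊔ ℓ)
  IsReflexive P = IsFano P × IsLatticePolytope (Dual P)

  TranslationEquivalent : Pred (Point d) ℓ → Pred (Point d) ℓ → Set (c ⊔ ℓ)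
  TranslationEquivalent {d = d} P Q = ∃ λ (t : Vector ℤ d) →
    ∀ x → x ∈ Q ⇔ (λ j → x j - fromℤᴷ (t j)) ∈ P

  IsFanoUpToTranslation : Pred (Point d) ℓ → Set (lsuc ℓ ⊔ c ⊔ ℓ₁ ⊔ ℓ₃)
  IsFanoUpToTranslation {d = d} {ℓ = ℓ} P =
    ∃ λ (Q : Pred (Point d) ℓ) → IsFano Q × TranslationEquivalent P Q

  IsReflexiveUpToTranslation : Pred (Point d) ℓ → Set (lsuc ℓ ⊔ c ⊔ ℓ₁ ⊔ ℓ₃)
  IsReflexiveUpToTranslation {d = d} {ℓ = ℓ} P =
    ∃ λ (Q : Pred (Point d) ℓ) → IsReflexive Q × TranslationEquivalent P Q

  -- With d = suc m, the consecutive pairs (i , i+1), 1 ≤ i ≤ d - 1, are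
  -- (inject₁ i , suc i) for i : Fin m.
  LectureHall : (s : Vector ℕ (suc m)) → (∀ i → NonZero (s i)) → Pred (Point (suc m)) ℓ₃
  LectureHall {m = m} s s≢0 x =
    0# ≤ ratio zero ×
    (∀ (i : Fin m) → ratio (inject₁ i) ≤ ratio (suc i)) ×
    ratio (fromℕ m) ≤ 1#
    where
    ratio : Fin (suc m) → Carrier
    ratio i = (x i / s i) {{s≢0 i}}

-- Fin m counts from 0, so the 1-based index of i : Fin m is suc (toℕ i).
k : Vector ℕ (suc m) → Fin m → ℤ
k s i = (+ suc (suc (toℕ i))) ℤ.* (+ s (inject₁ i)) ℤ.- (+ suc (toℕ i)) ℤ.* (+ s (suc i))

{-# OPTIONS --safe #-}
module Submission where

-- For an s-lecture hall polytope P with steps 0 or 1, a lattice point z with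
-- 0 < z₁/s₁ < ⋯ < z_d/s_d < 1 has i ≤ zᵢ < sᵢ, so (1,…,d) is one as well; its
-- uniqueness also gives s_d = d + 1.  Hence the only Fano translate of P is
-- Q = P - (1,…,d), in which the facet xᵢ/sᵢ ≤ xᵢ₊₁/sᵢ₊₁ reads ⟨x , uᵢ⟩ ≤ 1 with
-- uᵢ = (sᵢ₊₁ eᵢ - sᵢ eᵢ₊₁) / kᵢ, and the remaining two facets have the normals
-- -e₁ and e_d.
--
-- If the uᵢ are integral, then the dual is the hull of the normals: the
-- barycentric coordinates of y ∈ Q^∨ are positive multiples of 1 - ⟨w , y⟩ for
-- the vertices w of Q.  Conversely, over the dual the i-th coordinate has maximum
-- sᵢ₊₁/kᵢ and the (i+1)-st has minimum -sᵢ/kᵢ, both attained at uᵢ; for a lattice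
-- polytope these extreme values are integers.

open import Defs
import Algebra.Apartness.Properties.HeytingCommutativeRing as HeytingProperties
open import Algebra.Bundles using (CommutativeRing)
import Algebra.Properties.AbelianGroup as AbelianGroupProperties
import Algebra.Properties.Ring as RingProperties
import Algebra.Properties.Semiring.Mult as SemiringMult
import Algebra.Properties.Semiring.Sum as SemiringSum
import Algebra.Solver.Ring as RingSolver
open import Algebra.Solver.Ring.AlmostCommutativeRing
  using (fromCommutativeRing; _-Raw-AlmostCommutative⟶_)
open import Data.Fin.Base using (Fin; zero; suc; inject₁; fromℕ; toℕ)
open import Data.Fin.Induction using (<-weakInduction; >-weakInduction)
import Data.Fin.Properties as Fin
open import Data.Fin.Relation.Unary.Top using (view; ‵fromℕ; ‵inject₁)
open import Data.Integer.Base as ℤ using (ℤ; +_; -[1+_]; 0ℤ; 1ℤ; -1ℤ; _⊖_)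
open import Data.Integer.Divisibility.Signed using (_∣_; divides; _∣?_)
import Data.Integer.Properties as ℤ
open import Data.Maybe.Base using (Maybe; just; nothing)
open import Data.Nat.Base as ℕ using (ℕ; zero; suc; NonZero)
import Data.Nat.Properties as ℕ
open import Data.Product.Base using (_×_; _,_; proj₁; proj₂; ∃)
open import Data.Sum.Base using (_⊎_; inj₁; inj₂)
open import Data.Vec.Functional using (Vector; _∷_)
open import Function.Base using (_∘_)
open import Function.Bundles using (_⇔_; mk⇔; module Equivalence)
open import Relation.Binary.PropositionalEquality.Core as ≡ using (_≡_)
import Relation.Binary.Reasoning.Setoid as ≈-Reasoning
open import Relation.Nullary.Decidable.Core using (yes; no)
open import Relation.Nullary.Negation.Core using (contradiction)
open import Relation.Unary using (Pred; _∈_; _≐_)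

-- The order of the field is not decidable and `_≤_` is only a negated `_<_`, so no argument may
-- split on the sign of a field element. Case distinctions are therefore moved to ℤ: facet
-- inequalities are used with their denominators cleared, where an integer point satisfies them
-- strictly exactly when they hold with a slack of at least 1. The slack of the i-th facet at
-- (1,...,d) is kᵢ, which is how kᵢ enters. Reflexivity up to translation supplies a translate of
-- its own, not the Fano one of the hypothesis. The facets and the dual are hence studied for any
-- set whose shift by (1,...,d) has the members of the polytope, and both implications instantiate
-- this.

private
  variable
    n m : ℕ

-- Unit vectors and step vectors over ℤ.

δ : Fin n → Fin n → ℤ
δ zero    zero    = 1ℤ
δ zero    (suc j) = 0ℤ
δ (suc i) zero    = 0ℤ
δ (suc i) (suc j) = δ i j

δ-sym : ∀ (i j : Fin n) → δ i j ≡ δ j i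
δ-sym zero    zero    = ≡.refl
δ-sym zero    (suc j) = ≡.refl
δ-sym (suc i) zero    = ≡.refl
δ-sym (suc i) (suc j) = δ-sym i j

δ-inject₁ : ∀ (i j : Fin n) → δ (inject₁ i) (inject₁ j) ≡ δ i j
δ-inject₁ zero    zero    = ≡.refl
δ-inject₁ zero    (suc j) = ≡.refl
δ-inject₁ (suc i) zero    = ≡.refl
δ-inject₁ (suc i) (suc j) = δ-inject₁ i j

δ-fromℕ-inject₁ : ∀ (j : Fin n) → δ (fromℕ n) (inject₁ j) ≡ 0ℤ
δ-fromℕ-inject₁ zero    = ≡.refl
δ-fromℕ-inject₁ (suc j) = δ-fromℕ-inject₁ j

δ-diagonal : ∀ (i : Fin n) → δ i i ≡ 1ℤ
δ-diagonal zero    = ≡.refl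
δ-diagonal (suc i) = δ-diagonal i

δ-nonNegative : ∀ (i j : Fin n) → 0ℤ ℤ.≤ δ i j
δ-nonNegative zero    zero    = ℤ.+≤+ ℕ.z≤n
δ-nonNegative zero    (suc j) = ℤ.≤-refl
δ-nonNegative (suc i) zero    = ℤ.≤-refl
δ-nonNegative (suc i) (suc j) = δ-nonNegative i j

δ-inject₁-suc : ∀ (i : Fin n) → δ (inject₁ i) (suc i) ≡ 0ℤ
δ-inject₁-suc zero    = ≡.refl
δ-inject₁-suc (suc i) = δ-inject₁-suc i

δ≤1 : ∀ (i j : Fin n) → δ i j ℤ.≤ 1ℤ
δ≤1 zero    zero    = ℤ.≤-refl
δ≤1 zero    (suc j) = ℤ.+≤+ ℕ.z≤n
δ≤1 (suc i) zero    = ℤ.+≤+ ℕ.z≤n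
δ≤1 (suc i) (suc j) = δ≤1 i j

≡-or-δ≡0 : ∀ (i j : Fin n) → i ≡ j ⊎ δ i j ≡ 0ℤ
≡-or-δ≡0 zero    zero    = inj₁ ≡.refl
≡-or-δ≡0 zero    (suc j) = inj₂ ≡.refl
≡-or-δ≡0 (suc i) zero    = inj₂ ≡.refl
≡-or-δ≡0 (suc i) (suc j) with ≡-or-δ≡0 i j
... | inj₁ i≡j = inj₁ (≡.cong suc i≡j)
... | inj₂ δ≡0 = inj₂ δ≡0

-- The vertices of the lecture hall polytope are the vectors j ↦ χ f j * s j.
χ : Fin (suc n) → Fin n → ℤ
χ zero    j       = 1ℤ
χ (suc f) zero    = 0ℤ
χ (suc f) (suc j) = χ f j

χ-fromℕ : ∀ (j : Fin n) → χ (fromℕ n) j ≡ 0ℤ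
χ-fromℕ zero    = ≡.refl
χ-fromℕ (suc j) = χ-fromℕ j

χ-inject₁ : ∀ (i j : Fin n) → χ (inject₁ i) j ≡ δ i j ℤ.+ χ (suc i) j
χ-inject₁ zero    zero    = ≡.refl
χ-inject₁ zero    (suc j) = ≡.refl
χ-inject₁ (suc i) zero    = ≡.refl
χ-inject₁ (suc i) (suc j) = χ-inject₁ i j

0≤χ : ∀ f (j : Fin n) → 0ℤ ℤ.≤ χ f j
0≤χ zero    j       = ℤ.+≤+ ℕ.z≤n
0≤χ (suc f) zero    = ℤ.≤-refl
0≤χ (suc f) (suc j) = 0≤χ f j

χ≤1 : ∀ f (j : Fin n) → χ f j ℤ.≤ 1ℤ
χ≤1 zero    j       = ℤ.≤-refl
χ≤1 (suc f) zero    = ℤ.+≤+ ℕ.z≤n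
χ≤1 (suc f) (suc j) = χ≤1 f j

χ-mono : ∀ f (i : Fin n) → χ f (inject₁ i) ℤ.≤ χ f (suc i)
χ-mono zero    i       = ℤ.≤-refl
χ-mono (suc f) zero    = 0≤χ f zero
χ-mono (suc f) (suc i) = χ-mono f i

-- Integer vectors with all facet inequalities strict, tested in ℤ by cross-multiplication.

Strict : Vector ℕ (suc m) → Vector ℤ (suc m) → Set
Strict {m} s z =
  0ℤ ℤ.< z zero ×
  (∀ (i : Fin m) → + s (suc i) ℤ.* z (inject₁ i) ℤ.< + s (inject₁ i) ℤ.* z (suc i)) ×
  z (fromℕ m) ℤ.< + s (fromℕ m)

index : Vector ℤ m
index j = + suc (toℕ j)

module _ {m} {s : Vector ℕ (suc m)} where

  -- The ratios increase towards the last one, which is below 1; the induction descends from there.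
  Strict⇒<s : ∀ z → Strict s z → ∀ j → z j ℤ.< + s j
  Strict⇒<s z (_ , z↗ , z<s) = >-weakInduction (λ j → z j ℤ.< + s j) z<s step
    where
    open ℤ.≤-Reasoning
    step : ∀ i → z (suc i) ℤ.< + s (suc i) → z (inject₁ i) ℤ.< + s (inject₁ i)
    step i z<s = ℤ.*-cancelˡ-<-nonNeg (+ s (suc i)) (begin-strict
      + s (suc i) ℤ.* z (inject₁ i)     <⟨ z↗ i ⟩
      + s (inject₁ i) ℤ.* z (suc i)     ≤⟨ ℤ.*-monoˡ-≤-nonNeg (+ s (inject₁ i)) (ℤ.<⇒≤ z<s) ⟩
      + s (inject₁ i) ℤ.* + s (suc i)   ≡⟨ ℤ.*-comm (+ s (inject₁ i)) (+ s (suc i)) ⟩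
      + s (suc i) ℤ.* + s (inject₁ i)   ∎)

  module _ (s↗ : ∀ (i : Fin m) → s (inject₁ i) ℕ.≤ s (suc i)) where

    -- As s is nondecreasing, sᵢ zᵢ ≤ sᵢ₊₁ zᵢ < sᵢ zᵢ₊₁, so that z itself increases strictly; being
    -- integral and positive at the start, it gains at least 1 at each place.
    index≤Strict : ∀ z → Strict s z → ∀ j → index j ℤ.≤ z j
    index≤Strict z (0<z , z↗ , _) = <-weakInduction (λ j → index j ℤ.≤ z j) (ℤ.i<j⇒suc[i]≤j 0<z) step
      where
      open ℤ.≤-Reasoning
      step : ∀ i → index (inject₁ i) ℤ.≤ z (inject₁ i) → index (suc i) ℤ.≤ z (suc i)
      step i i≤z = ℤ.i<j⇒suc[i]≤j (ℤ.≤-<-trans index-inject₁≤z z<z)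
        where
        index-inject₁≤z : + suc (toℕ i) ℤ.≤ z (inject₁ i)
        index-inject₁≤z = ≡.subst (λ a → + suc a ℤ.≤ z (inject₁ i)) (Fin.toℕ-inject₁ i) i≤z
        z<z : z (inject₁ i) ℤ.< z (suc i)
        z<z = ℤ.*-cancelˡ-<-nonNeg (+ s (inject₁ i)) (begin-strict
          + s (inject₁ i) ℤ.* z (inject₁ i)   ≤⟨ ℤ.*-monoʳ-≤-nonNeg (z (inject₁ i)) {{ℤ.nonNegative (ℤ.≤-trans (ℤ.+≤+ ℕ.z≤n) i≤z)}} (ℤ.+≤+ (s↗ i)) ⟩
          + s (suc i) ℤ.* z (inject₁ i)       <⟨ z↗ i ⟩
          + s (inject₁ i) ℤ.* z (suc i)       ∎)

  module _ (s≤1+s : ∀ (i : Fin m) → s (suc i) ℕ.≤ suc (s (inject₁ i))) where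

    -- Growth by at most one enters here: sᵢ₊₁ i ≤ i + sᵢ i, and i < sᵢ makes this less than sᵢ (i +
    -- 1).
    index-Strict : (∀ (j : Fin (suc m)) → suc (toℕ j) ℕ.< s j) → Strict s index
    index-Strict index<s = ℤ.+<+ (ℕ.s≤s ℕ.z≤n) , middle , ℤ.+<+ (index<s (fromℕ m))
      where
      open ℕ.≤-Reasoning
      middle : ∀ i → + s (suc i) ℤ.* index (inject₁ i) ℤ.< + s (inject₁ i) ℤ.* index (suc i)
      middle i = ≡.subst₂ ℤ._<_ (ℤ.pos-* (s (suc i)) _) (ℤ.pos-* (s (inject₁ i)) _) (ℤ.+<+ (begin-strict
        s (suc i) ℕ.* suc (toℕ (inject₁ i))               ≡⟨ ≡.cong (λ a → s (suc i) ℕ.* suc a) (Fin.toℕ-inject₁ i) ⟩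
        s (suc i) ℕ.* suc (toℕ i)                         ≤⟨ ℕ.*-monoˡ-≤ (suc (toℕ i)) (s≤1+s i) ⟩
        suc (toℕ i) ℕ.+ s (inject₁ i) ℕ.* suc (toℕ i)     <⟨ ℕ.+-monoˡ-< (s (inject₁ i) ℕ.* suc (toℕ i)) i<s ⟩
        s (inject₁ i) ℕ.+ s (inject₁ i) ℕ.* suc (toℕ i)   ≡⟨ ℕ.*-suc (s (inject₁ i)) (suc (toℕ i)) ⟨
        s (inject₁ i) ℕ.* suc (suc (toℕ i))               ∎))
        where
        i<s : suc (toℕ i) ℕ.< s (inject₁ i)
        i<s = ≡.subst (λ a → suc a ℕ.< s (inject₁ i)) (Fin.toℕ-inject₁ i) (index<s (inject₁ i))

  -- Raising the last coordinate only widens the gap to the ratio before it, so the upper bound is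
  -- the single inequality at risk. This provides the competitor that pins down the last entry of s.
  raise-last-Strict : ∀ z → Strict s z → ℤ.suc (z (fromℕ m)) ℤ.< + s (fromℕ m) →
                      Strict s (λ j → z j ℤ.+ δ (fromℕ m) j)
  raise-last-Strict z (0<z , z↗ , _) 1+z<s =
    ℤ.<-≤-trans 0<z (z≤z′ zero) , middle ,
    ≡.subst (ℤ._< + s (fromℕ m)) (≡.trans (ℤ.+-comm 1ℤ (z (fromℕ m))) (≡.cong (λ a → z (fromℕ m) ℤ.+ a) (≡.sym (δ-diagonal (fromℕ m))))) 1+z<s
    where
    open ℤ.≤-Reasoning
    z≤z′ : ∀ j → z j ℤ.≤ z j ℤ.+ δ (fromℕ m) j
    z≤z′ j = ≡.subst (ℤ._≤ z j ℤ.+ δ (fromℕ m) j) (ℤ.+-identityʳ (z j)) (ℤ.+-monoʳ-≤ (z j) (δ-nonNegative (fromℕ m) j))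
    middle : ∀ i → + s (suc i) ℤ.* (z (inject₁ i) ℤ.+ δ (fromℕ m) (inject₁ i)) ℤ.<
                   + s (inject₁ i) ℤ.* (z (suc i) ℤ.+ δ (fromℕ m) (suc i))
    middle i = begin-strict
      + s (suc i) ℤ.* (z (inject₁ i) ℤ.+ δ (fromℕ m) (inject₁ i)) ≡⟨ ≡.cong (λ a → + s (suc i) ℤ.* (z (inject₁ i) ℤ.+ a)) (δ-fromℕ-inject₁ i) ⟩
      + s (suc i) ℤ.* (z (inject₁ i) ℤ.+ 0ℤ)                      ≡⟨ ≡.cong (λ a → + s (suc i) ℤ.* a) (ℤ.+-identityʳ (z (inject₁ i))) ⟩
      + s (suc i) ℤ.* z (inject₁ i)                                <⟨ z↗ i ⟩
      + s (inject₁ i) ℤ.* z (suc i)                                ≤⟨ ℤ.*-monoˡ-≤-nonNeg (+ s (inject₁ i)) (z≤z′ (suc i)) ⟩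
      + s (inject₁ i) ℤ.* (z (suc i) ℤ.+ δ (fromℕ m) (suc i))     ∎

  Strict-unique : (∀ i → s (inject₁ i) ℕ.≤ s (suc i)) → (∀ i → s (suc i) ℕ.≤ suc (s (inject₁ i))) →
                  ∀ z → Strict s z → (∀ w → Strict s w → ∀ j → w j ≡ z j) →
                  (∀ j → z j ≡ index j) × Strict s index × s (fromℕ m) ≡ suc (suc m)
  Strict-unique s↗ s≤1+s z z-strict unique = (λ j → ≡.sym (unique index index-strict j)) , index-strict , s≡m+2
    where
    index<s : ∀ j → suc (toℕ j) ℕ.< s j
    index<s j = ℤ.drop‿+<+ (ℤ.≤-<-trans (index≤Strict s↗ z z-strict j) (Strict⇒<s z z-strict j))
    index-strict : Strict s index
    index-strict = index-Strict s≤1+s index<s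
    s≡m+2 : s (fromℕ m) ≡ suc (suc m)
    s≡m+2 with ℕ.m≤n⇒m<n∨m≡n (index<s (fromℕ m))
    ... | inj₂ eq = ≡.trans (≡.sym eq) (≡.cong (λ a → suc (suc a)) (Fin.toℕ-fromℕ m))
    -- A larger last entry leaves room for (1,...,d-1,d+1) as a second strict vector, and uniqueness
    -- would equate d with d + 1.
    ... | inj₁ lt = contradiction (≡.trans (unique index index-strict (fromℕ m))
            (≡.trans (≡.sym (unique (λ j → index j ℤ.+ δ (fromℕ m) j) (raise-last-Strict index index-strict (ℤ.+<+ lt)) (fromℕ m)))
            (≡.trans (≡.cong (λ a → index (fromℕ m) ℤ.+ a) (δ-diagonal (fromℕ m))) (ℤ.+-comm (index (fromℕ m)) 1ℤ)))) ℤ.i≢suc[i]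

infixl 5 _∷ʳ_
-- Data of the middle facets is completed at the end by the facet x_d/s_d ≤ 1, and with `_∷_` at the
-- front by 0 ≤ x₁/s₁.
_∷ʳ_ : ∀ {a} {A : Set a} {n} → Vector A n → A → Vector A (suc n)
_∷ʳ_ {n = zero}  xs x _       = x
_∷ʳ_ {n = suc n} xs x zero    = xs zero
_∷ʳ_ {n = suc n} xs x (suc i) = (xs ∘ suc ∷ʳ x) i

∷ʳ-inject₁ : ∀ {a} {A : Set a} {n} (xs : Vector A n) x i → (xs ∷ʳ x) (inject₁ i) ≡ xs i
∷ʳ-inject₁ xs x zero    = ≡.refl
∷ʳ-inject₁ xs x (suc i) = ∷ʳ-inject₁ (xs ∘ suc) x i

∷ʳ-fromℕ : ∀ {a} {A : Set a} {n} (xs : Vector A n) x → (xs ∷ʳ x) (fromℕ n) ≡ x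
∷ʳ-fromℕ {n = zero}  xs x = ≡.refl
∷ʳ-fromℕ {n = suc n} xs x = ∷ʳ-fromℕ (xs ∘ suc) x

-- Ordered fields: the embedding of ℤ and constructive order arithmetic.

module OrderedFieldProperties {c ℓ₁ ℓ₂ ℓ₃} (K : OrderedField c ℓ₁ ℓ₂ ℓ₃) where

  open OrderedField K hiding (zero)
  open Geometry K
  open CommutativeRing commutativeRing using (ring; semiring; +-abelianGroup)
  open AbelianGroupProperties +-abelianGroup using (⁻¹-∙-comm)
  open RingProperties ring
    using (-‿involutive; -0#≈0#; -‿distribˡ-*; -‿distribʳ-*)
  open HeytingProperties heytingCommutativeRing
    using (#-congʳ; x-0≈x; invertibleˡ⇒#)
  open SemiringMult semiring using (×-homo-+; ×1-homo-*)
  open SemiringSum semiring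
    using (sum-cong-≋; ∑-distrib-+; ∑-comm; *-distribˡ-sum; *-distribʳ-sum; sum-replicate-zero)

  fromℤᴷ-⊖ : ∀ m n → fromℤᴷ (m ⊖ n) ≈ fromℕᴷ m - fromℕᴷ n
  fromℤᴷ-⊖ zero    zero    = sym (-‿inverseʳ 0#)
  fromℤᴷ-⊖ zero    (suc n) = sym (+-identityˡ _)
  fromℤᴷ-⊖ (suc m) zero    = sym (trans (+-congˡ -0#≈0#) (+-identityʳ _))
  fromℤᴷ-⊖ (suc m) (suc n) = begin
    fromℤᴷ (suc m ⊖ suc n)                   ≡⟨ ≡.cong fromℤᴷ (ℤ.[1+m]⊖[1+n]≡m⊖n m n) ⟩
    fromℤᴷ (m ⊖ n)                           ≈⟨ fromℤᴷ-⊖ m n ⟩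
    fromℕᴷ m - fromℕᴷ n                      ≈⟨ +-congʳ (+-identityˡ _) ⟨
    (0# + fromℕᴷ m) - fromℕᴷ n               ≈⟨ +-congʳ (+-congʳ (-‿inverseˡ 1#)) ⟨
    ((- 1# + 1#) + fromℕᴷ m) - fromℕᴷ n      ≈⟨ +-congʳ (+-assoc _ _ _) ⟩
    (- 1# + fromℕᴷ (suc m)) - fromℕᴷ n       ≈⟨ +-congʳ (+-comm _ _) ⟩
    (fromℕᴷ (suc m) - 1#) - fromℕᴷ n         ≈⟨ +-assoc _ _ _ ⟩
    fromℕᴷ (suc m) + (- 1# - fromℕᴷ n)       ≈⟨ +-congˡ (⁻¹-∙-comm 1# _) ⟩
    fromℕᴷ (suc m) - fromℕᴷ (suc n)          ∎
    where open ≈-Reasoning setoid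

  fromℤᴷ-neg : ∀ a → fromℤᴷ (ℤ.- a) ≈ - fromℤᴷ a
  fromℤᴷ-neg (+ zero)  = sym -0#≈0#
  fromℤᴷ-neg (+ suc n) = refl
  fromℤᴷ-neg -[1+ n ]  = sym (-‿involutive _)

  fromℤᴷ-+ : ∀ a b → fromℤᴷ (a ℤ.+ b) ≈ fromℤᴷ a + fromℤᴷ b
  fromℤᴷ-+ (+ m)    (+ n)    = ×-homo-+ 1# m n
  fromℤᴷ-+ (+ m)    -[1+ n ] = fromℤᴷ-⊖ m (suc n)
  fromℤᴷ-+ -[1+ m ] (+ n)    = trans (fromℤᴷ-⊖ n (suc m)) (+-comm _ _)
  fromℤᴷ-+ -[1+ m ] -[1+ n ] = begin
    - fromℕᴷ (suc (suc (m ℕ.+ n)))     ≡⟨ ≡.cong (λ l → - fromℕᴷ (suc l)) (ℕ.+-suc m n) ⟨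
    - fromℕᴷ (suc m ℕ.+ suc n)         ≈⟨ -‿cong (×-homo-+ 1# (suc m) (suc n)) ⟩
    - (fromℕᴷ (suc m) + fromℕᴷ (suc n)) ≈⟨ ⁻¹-∙-comm _ _ ⟨
    - fromℕᴷ (suc m) - fromℕᴷ (suc n)  ∎
    where open ≈-Reasoning setoid

  fromℤᴷ-pos-* : ∀ m b → fromℤᴷ (+ m ℤ.* b) ≈ fromℕᴷ m * fromℤᴷ b
  fromℤᴷ-pos-* m (+ n) =
    trans (reflexive (≡.cong fromℤᴷ (≡.sym (ℤ.pos-* m n)))) (×1-homo-* m n)
  fromℤᴷ-pos-* m -[1+ n ] = begin
    fromℤᴷ (+ m ℤ.* -[1+ n ])          ≡⟨ ≡.cong fromℤᴷ (ℤ.neg-distribʳ-* (+ m) (+ suc n)) ⟨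
    fromℤᴷ (ℤ.- (+ m ℤ.* + suc n))     ≈⟨ fromℤᴷ-neg (+ m ℤ.* + suc n) ⟩
    - fromℤᴷ (+ m ℤ.* + suc n)         ≈⟨ -‿cong (fromℤᴷ-pos-* m (+ suc n)) ⟩
    - (fromℕᴷ m * fromℕᴷ (suc n))      ≈⟨ -‿distribʳ-* _ _ ⟩
    fromℕᴷ m * - fromℕᴷ (suc n)        ∎
    where open ≈-Reasoning setoid

  fromℤᴷ-* : ∀ a b → fromℤᴷ (a ℤ.* b) ≈ fromℤᴷ a * fromℤᴷ b
  fromℤᴷ-* (+ m)    b = fromℤᴷ-pos-* m b
  fromℤᴷ-* -[1+ m ] b = begin
    fromℤᴷ (-[1+ m ] ℤ.* b)            ≡⟨ ≡.cong fromℤᴷ (ℤ.neg-distribˡ-* (+ suc m) b) ⟨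
    fromℤᴷ (ℤ.- (+ suc m ℤ.* b))       ≈⟨ fromℤᴷ-neg (+ suc m ℤ.* b) ⟩
    - fromℤᴷ (+ suc m ℤ.* b)           ≈⟨ -‿cong (fromℤᴷ-pos-* (suc m) b) ⟩
    - (fromℕᴷ (suc m) * fromℤᴷ b)      ≈⟨ -‿distribˡ-* _ _ ⟩
    - fromℕᴷ (suc m) * fromℤᴷ b        ∎
    where open ≈-Reasoning setoid

  -- Gives the ring solver integer coefficients under the same embedding as the lattice points.
  -- There `con 1ℤ` denotes `1# + 0#`, so identities about `1#` itself pass it as a variable.
  fromℤᴷ-homomorphism : ℤ.+-*-rawRing -Raw-AlmostCommutative⟶ fromCommutativeRing commutativeRing
  fromℤᴷ-homomorphism = record
    { ⟦_⟧    = fromℤᴷ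
    ; +-homo = fromℤᴷ-+
    ; *-homo = fromℤᴷ-*
    ; -‿homo = fromℤᴷ-neg
    ; 0-homo = refl
    ; 1-homo = +-identityʳ 1#
    }

  fromℤᴷ-≟ : ∀ a b → Maybe (fromℤᴷ a ≈ fromℤᴷ b)
  fromℤᴷ-≟ a b with a ℤ.≟ b
  ... | yes a≡b = just (reflexive (≡.cong fromℤᴷ a≡b))
  ... | no  _   = nothing

  open RingSolver ℤ.+-*-rawRing (fromCommutativeRing commutativeRing) fromℤᴷ-homomorphism fromℤᴷ-≟ public
    using (solve; con; _:+_; _:*_; _:-_; :-_; _:=_)

  fromℤᴷ-- : ∀ a b → fromℤᴷ (a ℤ.- b) ≈ fromℤᴷ a - fromℤᴷ b
  fromℤᴷ-- a b = trans (fromℤᴷ-+ a (ℤ.- b)) (+-congˡ (fromℤᴷ-neg b))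

  fromℤᴷ-1 : fromℤᴷ 1ℤ ≈ 1#
  fromℤᴷ-1 = +-identityʳ 1#

  ≈⇒≤ : ∀ {x y} → x ≈ y → x ≤ y
  ≈⇒≤ x≈y = <-irrefl (sym x≈y)

  <⇒≤ : ∀ {x y} → x < y → x ≤ y
  <⇒≤ x<y y<x = <-irrefl refl (<-trans x<y y<x)

  ≤-resp-≈ : ∀ {x x′ y y′} → x ≈ x′ → y ≈ y′ → x ≤ y → x′ ≤ y′
  ≤-resp-≈ x≈x′ y≈y′ x≤y y′<x′ = x≤y (<-respˡ-≈ (sym y≈y′) (<-respʳ-≈ (sym x≈x′) y′<x′))

  -- The substitute for trichotomy: z is apart from x or from y, and if it lies on the outer side of
  -- that one, transitivity yields the other alternative.
  <-cotrans : ∀ {x y} → x < y → ∀ z → x < z ⊎ z < y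
  <-cotrans x<y z with #-cotrans (<⇒# x<y) z
  ... | inj₁ x#z with #⇒<⊎> x#z
  ...   | inj₁ x<z = inj₁ x<z
  ...   | inj₂ z<x = inj₂ (<-trans z<x x<y)
  <-cotrans x<y z | inj₂ z#y with #⇒<⊎> z#y
  ...   | inj₁ z<y = inj₂ z<y
  ...   | inj₂ y<z = inj₁ (<-trans x<y y<z)

  <-≤-trans : ∀ {x y z} → x < y → y ≤ z → x < z
  <-≤-trans {z = z} x<y y≤z with <-cotrans x<y z
  ... | inj₁ x<z = x<z
  ... | inj₂ z<y = contradiction z<y y≤z

  ≤-trans : ∀ {x y z} → x ≤ y → y ≤ z → x ≤ z
  ≤-trans x≤y y≤z z<x = y≤z (<-≤-trans z<x x≤y)

  x<y⇒0<y-x : ∀ {x y} → x < y → 0# < y - x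
  x<y⇒0<y-x {x} {y} x<y =
    <-respˡ-≈ (-‿inverseˡ x) (<-respʳ-≈ (+-comm (- x) y) (+-monoʳ-< (- x) x<y))

  0<y-x⇒x<y : ∀ {x y} → 0# < y - x → x < y
  0<y-x⇒x<y {x} {y} 0<y-x = <-respˡ-≈ (+-identityʳ x)
    (<-respʳ-≈ (solve 2 (λ a b → a :+ (b :- a) := b) refl x y) (+-monoʳ-< x 0<y-x))

  -- The pattern of most inequalities below: the difference of the sides is exhibited as an
  -- expression of known sign, which leaves a ring identity.
  0<⇒< : ∀ {x y e} → 0# < e → e ≈ y - x → x < y
  0<⇒< 0<e e≈y-x = 0<y-x⇒x<y (<-respʳ-≈ e≈y-x 0<e)

  0≤⇒≤ : ∀ {x y e} → 0# ≤ e → e ≈ y - x → x ≤ y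
  0≤⇒≤ {x} {y} {e} 0≤e e≈y-x y<x = 0≤e (0<⇒< (x<y⇒0<y-x y<x)
    (trans (solve 2 (λ a b → a :- b := con 0ℤ :- (b :- a)) refl x y) (+-congˡ (-‿cong (sym e≈y-x)))))

  x≤y⇒0≤y-x : ∀ {x y} → x ≤ y → 0# ≤ y - x
  x≤y⇒0≤y-x {x} {y} x≤y y-x<0 = x≤y (0<⇒< (x<y⇒0<y-x y-x<0)
    (solve 2 (λ a b → con 0ℤ :- (b :- a) := a :- b) refl x y))

  0≤-+ : ∀ {x y} → 0# ≤ x → 0# ≤ y → 0# ≤ x + y
  0≤-+ {x} {y} 0≤x 0≤y = ≤-trans 0≤x
    (0≤⇒≤ 0≤y (solve 2 (λ a b → b := (a :+ b) :- a) refl x y))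

  0<-+ : ∀ {x y} → 0# < x → 0# ≤ y → 0# < x + y
  0<-+ {x} {y} 0<x 0≤y = <-≤-trans 0<x
    (0≤⇒≤ 0≤y (solve 2 (λ a b → b := (a :+ b) :- a) refl x y))

  *-invertibleˡ : ∀ {x y} → x * y # 0# → x # 0#
  *-invertibleˡ {x} {y} xy#0 with #⇒invertible xy#0
  ... | z , _ , xyz≈1 = invertibleˡ⇒#
    (y * z , trans (solve 3 (λ a b c → b :* c :* (a :- con 0ℤ) := (a :* b :- con 0ℤ) :* c) refl x y z) xyz≈1)

  0≤∧#0⇒0< : ∀ {x} → 0# ≤ x → x # 0# → 0# < x
  0≤∧#0⇒0< 0≤x x#0 with #⇒<⊎> x#0
  ... | inj₁ x<0 = contradiction x<0 0≤x
  ... | inj₂ 0<x = 0<x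

  -- Whether a factor vanishes cannot be decided, but a negative product is apart from 0. Then both
  -- factors are too, hence they are positive, and so is the product.
  0≤-* : ∀ {x y} → 0# ≤ x → 0# ≤ y → 0# ≤ x * y
  0≤-* {x} {y} 0≤x 0≤y xy<0 = <⇒≤ (*-positive
      (0≤∧#0⇒0< 0≤x (*-invertibleˡ (<⇒# xy<0)))
      (0≤∧#0⇒0< 0≤y (*-invertibleˡ (#-congʳ (*-comm x y) (<⇒# xy<0)))))
    xy<0

  0<-inverse : ∀ {x y} → 0# < x → x * y ≈ 1# → 0# < y
  0<-inverse {x} {y} 0<x xy≈1 with #⇒<⊎> (invertibleˡ⇒# {y} {0#} (x , trans (*-congˡ (x-0≈x y)) xy≈1))
  ... | inj₂ 0<y = 0<y
  ... | inj₁ y<0 = contradiction (<-trans 0<1 (0<⇒< (*-positive 0<x (x<y⇒0<y-x y<0))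
    (trans (solve 2 (λ a b → a :* (con 0ℤ :- b) := con 0ℤ :- a :* b) refl x y) (+-congˡ (-‿cong xy≈1)))))
    (<-irrefl refl)

  *-monoʳ-≤ : ∀ {z x y} → 0# ≤ z → x ≤ y → z * x ≤ z * y
  *-monoʳ-≤ {z} {x} {y} 0≤z x≤y = 0≤⇒≤ (0≤-* 0≤z (x≤y⇒0≤y-x x≤y))
    (solve 3 (λ a b c → a :* (c :- b) := a :* c :- a :* b) refl z x y)

  +-mono-≤ : ∀ {x y u v} → x ≤ y → u ≤ v → x + u ≤ y + v
  +-mono-≤ {x} {y} {u} {v} x≤y u≤v = 0≤⇒≤ (0≤-+ (x≤y⇒0≤y-x x≤y) (x≤y⇒0≤y-x u≤v))
    (solve 4 (λ a b c d → (b :- a) :+ (d :- c) := (b :+ d) :- (a :+ c)) refl x y u v)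

  sum-mono-≤ : ∀ {n} {x y : Vector Carrier n} → (∀ i → x i ≤ y i) → sum x ≤ sum y
  sum-mono-≤ {zero}  x≤y = ≈⇒≤ refl
  sum-mono-≤ {suc n} x≤y = +-mono-≤ (x≤y zero) (sum-mono-≤ (λ i → x≤y (suc i)))

  0≤fromℕᴷ : ∀ n → 0# ≤ fromℕᴷ n
  0≤fromℕᴷ zero    = ≈⇒≤ refl
  0≤fromℕᴷ (suc n) = <⇒≤ (0<fromℕᴷ (suc n))

  fromℤᴷ-0≤ : ∀ {a} → 0ℤ ℤ.≤ a → 0# ≤ fromℤᴷ a
  fromℤᴷ-0≤ {+ n} _ = 0≤fromℕᴷ n

  fromℤᴷ-mono-≤ : ∀ {a b} → a ℤ.≤ b → fromℤᴷ a ≤ fromℤᴷ b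
  fromℤᴷ-mono-≤ {a} {b} a≤b = 0≤⇒≤ (fromℤᴷ-0≤ (ℤ.i≤j⇒0≤j-i a≤b)) (fromℤᴷ-- b a)

  fromℤᴷ-cancel-< : ∀ {a b} → fromℤᴷ a < fromℤᴷ b → a ℤ.< b
  fromℤᴷ-cancel-< a<b = ℤ.≰⇒> λ b≤a → fromℤᴷ-mono-≤ b≤a a<b

  -- Turns integrality into a unit of slack in the field. This unit pays for the radius of a cube
  -- around an interior lattice point and for the drop to b - 1 in `average-divides`.
  fromℤᴷ-suc≤ : ∀ {a b} → a ℤ.< b → 1# + fromℤᴷ a ≤ fromℤᴷ b
  fromℤᴷ-suc≤ {a} a<b = ≤-resp-≈
    (trans (fromℤᴷ-+ 1ℤ a) (+-congʳ fromℤᴷ-1)) refl (fromℤᴷ-mono-≤ (ℤ.i<j⇒suc[i]≤j a<b))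

  fromℤᴷ-mono-< : ∀ {a b} → a ℤ.< b → fromℤᴷ a < fromℤᴷ b
  fromℤᴷ-mono-< {a} a<b = <-≤-trans
    (0<⇒< 0<1 (solve 2 (λ o x → o := (o :+ x) :- x) refl 1# (fromℤᴷ a)))
    (fromℤᴷ-suc≤ a<b)

  fromℤᴷ-cancel-≤ : ∀ {a b} → fromℤᴷ a ≤ fromℤᴷ b → a ℤ.≤ b
  fromℤᴷ-cancel-≤ a≤b = ℤ.≮⇒≥ λ b<a → a≤b (fromℤᴷ-mono-< b<a)

  recip-inverse : ∀ n .{{_ : NonZero n}} → fromℕᴷ n * recip n ≈ 1#
  recip-inverse n = trans (*-congʳ (sym (x-0≈x _)))
    (proj₂ (proj₂ (#⇒invertible (#-sym (<⇒# (0<fromℕᴷ n))))))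

  0<recip : ∀ n .{{_ : NonZero n}} → 0# < recip n
  0<recip n = 0<-inverse (0<fromℕᴷ n) (recip-inverse n)

  x≈y⇒x-y≈0 : ∀ {x y} → x ≈ y → x - y ≈ 0#
  x≈y⇒x-y≈0 {x} {y} x≈y = trans (+-congʳ x≈y) (-‿inverseʳ y)

  -- Used to discharge an equation in an identity left to the ring solver.
  +-vanishʳ : ∀ {x y z} → y ≈ z → x + (y - z) ≈ x
  +-vanishʳ y≈z = trans (+-congˡ (x≈y⇒x-y≈0 y≈z)) (+-identityʳ _)

  sum-0 : ∀ {n} {x : Vector Carrier n} → (∀ j → x j ≈ 0#) → sum x ≈ 0#
  sum-0 {n} x≈0 = trans (sum-cong-≋ x≈0) (sum-replicate-zero n)

  sum-δ : ∀ {n} i (x : Vector Carrier n) → sum (λ j → fromℤᴷ (δ i j) * x j) ≈ x i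
  sum-δ zero    x = trans
    (+-cong (trans (*-congʳ fromℤᴷ-1) (*-identityˡ _)) (sum-0 λ j → zeroˡ (x (suc j))))
    (+-identityʳ _)
  sum-δ (suc i) x = trans (+-cong (zeroˡ (x zero)) (sum-δ i (x ∘ suc))) (+-identityˡ _)

  0<⇒invertible : ∀ {x} → 0# < x → ∃ λ y → 0# < y × x * y ≈ 1#
  0<⇒invertible {x} 0<x with #⇒invertible (#-sym (<⇒# 0<x))
  ... | y , _ , [x-0]y≈1 = y , 0<-inverse 0<x xy≈1 , xy≈1
    where
    xy≈1 : x * y ≈ 1#
    xy≈1 = trans (*-congʳ (sym (x-0≈x x))) [x-0]y≈1

  -- Convex combinations and averages of integers.

  lattice-vertex∈hull : ∀ {d n} (v : Fin n → Vector ℤ d) i → latticePoint (v i) ∈ ConvexHull (latticePoint ∘ v)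
  lattice-vertex∈hull v i = (λ a → fromℤᴷ (δ i a)) , (λ a → fromℤᴷ-0≤ (δ-nonNegative i a)) ,
    trans (sum-cong-≋ (λ a → sym (*-identityʳ (fromℤᴷ (δ i a))))) (sum-δ i (λ _ → 1#)) ,
    λ j → sym (sum-δ i (λ a → fromℤᴷ (v a j)))

  ⟨,⟩-combination : ∀ {d n} (p : Fin n → Point d) (μ : Vector Carrier n) (x y : Point d) → (∀ j → y j ≈ sum (λ a → μ a * p a j)) →
                    ⟨ x , y ⟩ ≈ sum (λ a → μ a * ⟨ x , p a ⟩)
  ⟨,⟩-combination p μ x y y≈ = begin
    sum (λ j → x j * y j)                         ≈⟨ sum-cong-≋ (λ j → *-congˡ (y≈ j)) ⟩
    sum (λ j → x j * sum (λ a → μ a * p a j))     ≈⟨ sum-cong-≋ (λ j → *-distribˡ-sum (x j) (λ a → μ a * p a j)) ⟩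
    sum (λ j → sum (λ a → x j * (μ a * p a j)))   ≈⟨ ∑-comm (λ j a → x j * (μ a * p a j)) ⟩
    sum (λ a → sum (λ j → x j * (μ a * p a j)))
      ≈⟨ sum-cong-≋ (λ a → sum-cong-≋ λ j → solve 3 (λ x m p → x :* (m :* p) := m :* (x :* p)) refl (x j) (μ a) (p a j)) ⟩
    sum (λ a → sum (λ j → μ a * (x j * p a j)))   ≈⟨ sum-cong-≋ (λ a → *-distribˡ-sum (μ a) (λ j → x j * p a j)) ⟨
    sum (λ a → μ a * ⟨ x , p a ⟩)                 ∎
    where open ≈-Reasoning setoid

  average≤ : ∀ {n} (μ w : Vector Carrier n) b → (∀ a → 0# ≤ μ a) → sum μ ≈ 1# → (∀ a → w a ≤ b) →
             sum (λ a → μ a * w a) ≤ b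
  average≤ μ w b 0≤μ Σμ≈1 w≤b = ≤-resp-≈ refl
    (trans (sym (*-distribʳ-sum b μ)) (trans (*-congʳ Σμ≈1) (*-identityˡ b)))
    (sum-mono-≤ (λ a → *-monoʳ-≤ (0≤μ a) (w≤b a)))

  -- If no c v a attained b, then by integrality all would be at most b - 1.
  average-divides : ∀ {n} (μ : Vector Carrier n) (v : Vector ℤ n) c b → (∀ a → 0# ≤ μ a) → sum μ ≈ 1# →
                    (∀ a → c ℤ.* v a ℤ.≤ b) → fromℤᴷ c * sum (λ a → μ a * fromℤᴷ (v a)) ≈ fromℤᴷ b →
                    c ∣ b
  average-divides μ v c b 0≤μ Σμ≈1 cv≤b cΣ≈b with c ∣? b
  ... | yes c∣b = c∣b
  ... | no  c∤b = contradiction 0<1 (≤-resp-≈ (solve 2 (λ o b → b :- (b :- o) := o) refl 1# (fromℤᴷ b)) (-‿inverseʳ (fromℤᴷ b - 1#))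
      (+-mono-≤ b≤b-1 (≈⇒≤ refl)))
    where
    cv<b : ∀ a → c ℤ.* v a ℤ.< b
    cv<b a = ℤ.≤∧≢⇒< (cv≤b a) λ cv≡b → c∤b (divides (v a) (≡.trans (≡.sym cv≡b) (ℤ.*-comm c (v a))))
    b≤b-1 : fromℤᴷ b ≤ fromℤᴷ b - 1#
    b≤b-1 = ≤-resp-≈
      (begin
        sum (λ a → μ a * fromℤᴷ (c ℤ.* v a))             ≈⟨ sum-cong-≋ (λ a → trans (*-congˡ (fromℤᴷ-* c (v a)))
          (solve 3 (λ m c v → m :* (c :* v) := c :* (m :* v)) refl (μ a) (fromℤᴷ c) (fromℤᴷ (v a)))) ⟩
        sum (λ a → fromℤᴷ c * (μ a * fromℤᴷ (v a)))      ≈⟨ *-distribˡ-sum (fromℤᴷ c) (λ a → μ a * fromℤᴷ (v a)) ⟨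
        fromℤᴷ c * sum (λ a → μ a * fromℤᴷ (v a))        ≈⟨ cΣ≈b ⟩
        fromℤᴷ b                                          ∎)
      refl
      (average≤ μ (λ a → fromℤᴷ (c ℤ.* v a)) (fromℤᴷ b - 1#) 0≤μ Σμ≈1 λ a →
        0≤⇒≤ (x≤y⇒0≤y-x (fromℤᴷ-suc≤ (cv<b a)))
          (solve 3 (λ o x b → b :- (o :+ x) := (b :- o) :- x) refl 1# (fromℤᴷ (c ℤ.* v a)) (fromℤᴷ b)))
      where open ≈-Reasoning setoid

-- The lecture hall polytope and its interior lattice points.

module LectureHallProperties {c ℓ₁ ℓ₂ ℓ₃} (K : OrderedField c ℓ₁ ℓ₂ ℓ₃)
  {m} (s : Vector ℕ (suc m)) (s≢0 : ∀ i → NonZero (s i)) where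

  open OrderedField K hiding (zero)
  open Geometry K
  open OrderedFieldProperties K
  open CommutativeRing commutativeRing using (semiring)
  open SemiringSum semiring using (sum-cong-≋; ∑-distrib-+; sum-init-last)

  S R : Fin (suc m) → Carrier
  S j = fromℕᴷ (s j)
  R j = recip (s j) {{s≢0 j}}

  SR≈1 : ∀ j → S j * R j ≈ 1#
  SR≈1 j = recip-inverse (s j) {{s≢0 j}}

  0≤S : ∀ j → 0# ≤ S j
  0≤S j = 0≤fromℕᴷ (s j)

  0<S : ∀ j → 0# < S j
  0<S j = 0<fromℕᴷ (s j) {{s≢0 j}}

  0≤R : ∀ j → 0# ≤ R j
  0≤R j = <⇒≤ (0<recip (s j) {{s≢0 j}})

  -- Free of reciprocals, so that at integer points both sides of each inequality come from ℤ.
  Hall : Pred (Point (suc m)) ℓ₃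
  Hall x =
    0# ≤ x zero ×
    (∀ (i : Fin m) → S (suc i) * x (inject₁ i) ≤ S (inject₁ i) * x (suc i)) ×
    x (fromℕ m) ≤ S (fromℕ m)

  cancel-SR : ∀ j e → e * (S j * R j) ≈ e
  cancel-SR j e = trans (*-congˡ (SR≈1 j)) (*-identityʳ e)

  LectureHall⇒Hall : ∀ x → x ∈ LectureHall s s≢0 → x ∈ Hall
  LectureHall⇒Hall x (0≤x , x↗ , x≤1) =
    ≤-resp-≈ (zeroʳ _) (scale zero) (*-monoʳ-≤ (0≤S zero) 0≤x) ,
    (λ i → ≤-resp-≈
      (trans (solve 4 (λ a b y r → a :* b :* (y :* r) := b :* y :* (a :* r)) refl (S (inject₁ i)) (S (suc i)) (x (inject₁ i)) (R (inject₁ i))) (cancel-SR (inject₁ i) _))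
      (trans (solve 4 (λ a b y r → a :* b :* (y :* r) := a :* y :* (b :* r)) refl (S (inject₁ i)) (S (suc i)) (x (suc i)) (R (suc i))) (cancel-SR (suc i) _))
      (*-monoʳ-≤ (0≤-* (0≤S (inject₁ i)) (0≤S (suc i))) (x↗ i))) ,
    ≤-resp-≈ (scale (fromℕ m)) (*-identityʳ _) (*-monoʳ-≤ (0≤S (fromℕ m)) x≤1)
    where
    scale : ∀ j → S j * (x j * R j) ≈ x j
    scale j = trans (solve 3 (λ a y r → a :* (y :* r) := y :* (a :* r)) refl (S j) (x j) (R j)) (cancel-SR j (x j))

  Hall⇒LectureHall : ∀ x → x ∈ Hall → x ∈ LectureHall s s≢0
  Hall⇒LectureHall x (0≤x , x↗ , x≤S) =
    0≤-* 0≤x (0≤R zero) ,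
    (λ i → ≤-resp-≈
      (trans (solve 4 (λ a r b y → a :* r :* (b :* y) := y :* a :* (b :* r)) refl (R (inject₁ i)) (R (suc i)) (S (suc i)) (x (inject₁ i))) (cancel-SR (suc i) _))
      (trans (solve 4 (λ a r b y → a :* r :* (b :* y) := y :* r :* (b :* a)) refl (R (inject₁ i)) (R (suc i)) (S (inject₁ i)) (x (suc i))) (cancel-SR (inject₁ i) _))
      (*-monoʳ-≤ (0≤-* (0≤R (inject₁ i)) (0≤R (suc i))) (x↗ i))) ,
    ≤-resp-≈ (*-comm _ _) (trans (*-comm _ _) (SR≈1 (fromℕ m))) (*-monoʳ-≤ (0≤R (fromℕ m)) x≤S)

  Hall-resp-≈ : ∀ x y → (∀ j → x j ≈ y j) → x ∈ Hall → y ∈ Hall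
  Hall-resp-≈ _ _ x≈y (0≤x , x↗ , x≤S) =
    ≤-resp-≈ refl (x≈y zero) 0≤x ,
    (λ i → ≤-resp-≈ (*-congˡ (x≈y (inject₁ i))) (*-congˡ (x≈y (suc i))) (x↗ i)) ,
    ≤-resp-≈ (x≈y (fromℕ m)) refl x≤S

  -- Each facet is tested by a small step towards it: all coordinates down for the first facet, all
  -- up for the last, coordinate i up for the middle one. The inequality survives the step, so it
  -- was strict before.
  interior⇒Strict : ∀ z → latticePoint z ∈ Interior Hall → Strict s z
  interior⇒Strict z (ε , 0<ε , cube) =
    fromℤᴷ-cancel-< (0<⇒< (0<-+ 0<η (x≤y⇒0≤y-x (proj₁ lower)))
      (solve 2 (λ h a → h :+ (a :+ con -1ℤ :* h :- con 0ℤ) := a :- con 0ℤ) refl η (fromℤᴷ (z zero)))) ,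
    middle ,
    fromℤᴷ-cancel-< (0<⇒< (0<-+ 0<η (x≤y⇒0≤y-x (proj₂ (proj₂ upper))))
      (solve 3 (λ h a b → h :+ (b :- (a :+ con 1ℤ :* h)) := b :- a) refl η (fromℤᴷ (z (fromℕ m))) (S (fromℕ m))))
    where
    -- Half the radius, because the cube is open: steps by η along directions with entries in
    -- [-1 , 1] stay strictly inside.
    η = ε * recip 2
    0<η : 0# < η
    0<η = *-positive 0<ε (0<recip 2)
    η+η≈ε : η + η ≈ ε
    η+η≈ε = begin
      ε * recip 2 + ε * recip 2      ≈⟨ solve 2 (λ e h → e :* h :+ e :* h := e :* (con (+ 2) :* h)) refl ε (recip 2) ⟩
      ε * (fromℕᴷ 2 * recip 2)       ≈⟨ *-congˡ (recip-inverse 2) ⟩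
      ε * 1#                         ≈⟨ *-identityʳ ε ⟩
      ε                              ∎
      where open ≈-Reasoning setoid
    perturb : ∀ (w : Vector ℤ (suc m)) → (∀ j → -1ℤ ℤ.≤ w j) → (∀ j → w j ℤ.≤ 1ℤ) →
              (λ j → fromℤᴷ (z j) + fromℤᴷ (w j) * η) ∈ Hall
    perturb w -1≤w w≤1 = cube _ λ j →
      0<⇒< (0<-+ 0<η (0≤-* (x≤y⇒0≤y-x (fromℤᴷ-mono-≤ (-1≤w j))) (<⇒≤ 0<η)))
        (trans (solve 3 (λ h a b → h :+ (b :- con -1ℤ) :* h := (a :+ b :* h) :- (a :- (h :+ h))) refl η (fromℤᴷ (z j)) (fromℤᴷ (w j)))
          (+-congˡ (-‿cong (+-congˡ (-‿cong η+η≈ε))))) ,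
      0<⇒< (0<-+ 0<η (0≤-* (x≤y⇒0≤y-x (fromℤᴷ-mono-≤ (w≤1 j))) (<⇒≤ 0<η)))
        (trans (solve 3 (λ h a b → h :+ (con 1ℤ :- b) :* h := (a :+ (h :+ h)) :- (a :+ b :* h)) refl η (fromℤᴷ (z j)) (fromℤᴷ (w j)))
          (+-congʳ (+-congˡ η+η≈ε)))
    lower = perturb (λ _ → -1ℤ) (λ _ → ℤ.≤-refl) (λ _ → ℤ.-≤+)
    upper = perturb (λ _ → 1ℤ) (λ _ → ℤ.-≤+) (λ _ → ℤ.≤-refl)
    middle : ∀ i → + s (suc i) ℤ.* z (inject₁ i) ℤ.< + s (inject₁ i) ℤ.* z (suc i)
    middle i = fromℤᴷ-cancel-< (0<⇒< (0<-+ (*-positive (0<S (suc i)) 0<η) (x≤y⇒0≤y-x bumped))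
      (begin
        S (suc i) * η + (S (inject₁ i) * (zᴷ (suc i) + fromℤᴷ (δ (inject₁ i) (suc i)) * η) - S (suc i) * (zᴷ (inject₁ i) + fromℤᴷ (δ (inject₁ i) (inject₁ i)) * η))
          ≡⟨ ≡.cong₂ (λ a b → S (suc i) * η + (S (inject₁ i) * (zᴷ (suc i) + fromℤᴷ a * η) - S (suc i) * (zᴷ (inject₁ i) + fromℤᴷ b * η)))
               (δ-inject₁-suc i) (δ-diagonal (inject₁ i)) ⟩
        S (suc i) * η + (S (inject₁ i) * (zᴷ (suc i) + fromℤᴷ 0ℤ * η) - S (suc i) * (zᴷ (inject₁ i) + fromℤᴷ 1ℤ * η))
          ≈⟨ solve 5 (λ a b x y h → a :* h :+ (b :* (y :+ con 0ℤ :* h) :- a :* (x :+ con 1ℤ :* h)) := b :* y :- a :* x)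
               refl (S (suc i)) (S (inject₁ i)) (zᴷ (inject₁ i)) (zᴷ (suc i)) η ⟩
        S (inject₁ i) * zᴷ (suc i) - S (suc i) * zᴷ (inject₁ i)
          ≈⟨ +-cong (fromℤᴷ-* (+ s (inject₁ i)) (z (suc i))) (-‿cong (fromℤᴷ-* (+ s (suc i)) (z (inject₁ i)))) ⟨
        fromℤᴷ (+ s (inject₁ i) ℤ.* z (suc i)) - fromℤᴷ (+ s (suc i) ℤ.* z (inject₁ i)) ∎))
      where
      open ≈-Reasoning setoid
      zᴷ : Fin (suc m) → Carrier
      zᴷ j = fromℤᴷ (z j)
      bumped = proj₁ (proj₂ (perturb (δ (inject₁ i)) (λ j → ℤ.≤-trans ℤ.-≤+ (δ-nonNegative (inject₁ i) j)) (δ≤1 (inject₁ i)))) i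

  Strict⇒interior : (∀ i → s (inject₁ i) ℕ.≤ s (suc i)) → ∀ z → Strict s z → latticePoint z ∈ Interior Hall
  Strict⇒interior s↗ z (0<z , z↗ , z<s) = ε , 0<recip N , λ y y∈cube →
    (≤-trans (0≤⇒≤ (0≤-+ (x≤y⇒0≤y-x ε≤1) (x≤y⇒0≤y-x (fromℤᴷ-suc≤ 0<z)))
        (solve 3 (λ o e a → (o :- e) :+ (a :- (o :+ con 0ℤ)) := (a :- e) :- con 0ℤ) refl 1# ε (fromℤᴷ (z zero))))
      (<⇒≤ (proj₁ (y∈cube zero)))) ,
    (λ i → middle y y∈cube i) ,
    ≤-trans (<⇒≤ (proj₂ (y∈cube (fromℕ m))))
      (0≤⇒≤ (0≤-+ (x≤y⇒0≤y-x ε≤1) (x≤y⇒0≤y-x (fromℤᴷ-suc≤ z<s)))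
        (solve 4 (λ o e a b → (o :- e) :+ (b :- (o :+ a)) := b :- (a :+ e)) refl 1# ε (fromℤᴷ (z (fromℕ m))) (S (fromℕ m))))
    where
    -- Moving the coordinates by at most ε changes sᵢ xᵢ₊₁ - sᵢ₊₁ xᵢ by at most (sᵢ + sᵢ₊₁) ε ≤ N ε
    -- = 1, the slack of a strict inequality in ℤ. The successor makes `N` visibly nonzero.
    N = suc (s (fromℕ m) ℕ.+ s (fromℕ m))
    ε = recip N
    0<ε = 0<recip N
    Nε≈1 = recip-inverse N
    ε≤1 : ε ≤ 1#
    ε≤1 = 0≤⇒≤ (0≤-* (x≤y⇒0≤y-x (fromℤᴷ-mono-≤ {1ℤ} {+ N} (ℤ.+≤+ (ℕ.s≤s ℕ.z≤n)))) (<⇒≤ 0<ε))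
      (trans (solve 3 (λ n e o → (n :- con 1ℤ) :* e := (o :- e) :+ (n :* e :- o)) refl (fromℕᴷ N) ε 1#) (+-vanishʳ Nε≈1))
    s≤s-last : ∀ j → s j ℕ.≤ s (fromℕ m)
    s≤s-last = >-weakInduction (λ j → s j ℕ.≤ s (fromℕ m)) ℕ.≤-refl (λ i → ℕ.≤-trans (s↗ i))
    S+S≤N : ∀ i j → S i + S j ≤ fromℕᴷ N
    S+S≤N i j = ≤-resp-≈ (fromℤᴷ-+ (+ s i) (+ s j)) refl
      (fromℤᴷ-mono-≤ {+ (s i ℕ.+ s j)} {+ N} (ℤ.+≤+ (ℕ.m≤n⇒m≤1+n (ℕ.+-mono-≤ (s≤s-last i) (s≤s-last j)))))
    middle : ∀ y → (∀ j → fromℤᴷ (z j) - ε < y j × y j < fromℤᴷ (z j) + ε) →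
             ∀ i → S (suc i) * y (inject₁ i) ≤ S (inject₁ i) * y (suc i)
    middle y y∈cube i = 0≤⇒≤
      (0≤-+ (0≤-+ (0≤-+
        (0≤-* (0≤S (inject₁ i)) (x≤y⇒0≤y-x (<⇒≤ (proj₁ (y∈cube (suc i))))))
        (0≤-* (0≤S (suc i)) (x≤y⇒0≤y-x (<⇒≤ (proj₂ (y∈cube (inject₁ i)))))))
        (x≤y⇒0≤y-x zᴷ↗))
        (0≤-* (x≤y⇒0≤y-x (S+S≤N (inject₁ i) (suc i))) (<⇒≤ 0<ε)))
      (trans (solve 9 (λ a b y y′ z z′ e n o →
          a :* (y′ :- (z′ :- e)) :+ b :* ((z :+ e) :- y) :+ (a :* z′ :- (o :+ b :* z)) :+ (n :- (a :+ b)) :* e :=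
          (a :* y′ :- b :* y) :+ (n :* e :- o))
        refl (S (inject₁ i)) (S (suc i)) (y (inject₁ i)) (y (suc i)) (fromℤᴷ (z (inject₁ i))) (fromℤᴷ (z (suc i))) ε (fromℕᴷ N) 1#)
        (+-vanishʳ Nε≈1))
      where
      zᴷ↗ : 1# + S (suc i) * fromℤᴷ (z (inject₁ i)) ≤ S (inject₁ i) * fromℤᴷ (z (suc i))
      zᴷ↗ = ≤-resp-≈ (+-congˡ (fromℤᴷ-* (+ s (suc i)) (z (inject₁ i)))) (fromℤᴷ-* (+ s (inject₁ i)) (z (suc i))) (fromℤᴷ-suc≤ (z↗ i))

  -- Fano translates and their centre.

  module Translate {Q : Pred (Point (suc m)) ℓ₃} (t : Vector ℤ (suc m))
    (Q⇔P : ∀ x → x ∈ Q ⇔ (λ j → x j - fromℤᴷ (t j)) ∈ LectureHall s s≢0) where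

    Q⇒Hall : ∀ x → x ∈ Q → (λ j → x j - fromℤᴷ (t j)) ∈ Hall
    Q⇒Hall x x∈Q = LectureHall⇒Hall (λ j → x j - fromℤᴷ (t j)) (Equivalence.to (Q⇔P x) x∈Q)

    Hall⇒Q : ∀ x → (λ j → x j - fromℤᴷ (t j)) ∈ Hall → x ∈ Q
    Hall⇒Q x x-t∈P = Equivalence.from (Q⇔P x) (Hall⇒LectureHall (λ j → x j - fromℤᴷ (t j)) x-t∈P)

    interior-- : ∀ z → latticePoint z ∈ Interior Q → latticePoint (λ j → z j ℤ.- t j) ∈ Interior Hall
    interior-- z (ε , 0<ε , cube) = ε , 0<ε , λ y y∈cube →
      Hall-resp-≈ (λ j → y j + fromℤᴷ (t j) - fromℤᴷ (t j)) y (λ j → solve 2 (λ a b → a :+ b :- b := a) refl (y j) (fromℤᴷ (t j)))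
        (Q⇒Hall (λ j → y j + fromℤᴷ (t j)) (cube (λ j → y j + fromℤᴷ (t j)) λ j →
          0<⇒< (x<y⇒0<y-x (proj₁ (y∈cube j)))
            (trans (+-congˡ (-‿cong (+-congʳ (fromℤᴷ-- (z j) (t j)))))
              (solve 4 (λ y z t e → y :- (z :- t :- e) := (y :+ t) :- (z :- e)) refl (y j) (fromℤᴷ (z j)) (fromℤᴷ (t j)) ε)) ,
          0<⇒< (x<y⇒0<y-x (proj₂ (y∈cube j)))
            (trans (+-congʳ (+-congʳ (fromℤᴷ-- (z j) (t j))))
              (solve 4 (λ y z t e → (z :- t :+ e) :- y := (z :+ e) :- (y :+ t)) refl (y j) (fromℤᴷ (z j)) (fromℤᴷ (t j)) ε))))

    interior-+ : ∀ z → latticePoint z ∈ Interior Hall → latticePoint (λ j → z j ℤ.+ t j) ∈ Interior Q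
    interior-+ z (ε , 0<ε , cube) = ε , 0<ε , λ y y∈cube →
      Hall⇒Q y (cube (λ j → y j - fromℤᴷ (t j)) λ j →
        0<⇒< (x<y⇒0<y-x (proj₁ (y∈cube j)))
          (trans (+-congˡ (-‿cong (+-congʳ (fromℤᴷ-+ (z j) (t j)))))
            (solve 4 (λ y z t e → y :- (z :+ t :- e) := (y :- t) :- (z :- e)) refl (y j) (fromℤᴷ (z j)) (fromℤᴷ (t j)) ε)) ,
        0<⇒< (x<y⇒0<y-x (proj₂ (y∈cube j)))
          (trans (+-congʳ (+-congʳ (fromℤᴷ-+ (z j) (t j))))
            (solve 4 (λ y z t e → (z :+ t :+ e) :- y := (z :+ e) :- (y :- t)) refl (y j) (fromℤᴷ (z j)) (fromℤᴷ (t j)) ε)))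

    -- The interior point 0 of `Q` comes from -t, and a strict w gives the interior lattice point w
    -- + t of `Q`, which must be 0. So -t is the unique strict vector; the form `0ℤ ℤ.- t j` is what
    -- shifting the zero vector back produces.
    fano : (∀ i → s (inject₁ i) ℕ.≤ s (suc i)) → (∀ i → s (suc i) ℕ.≤ suc (s (inject₁ i))) → IsFano Q →
           (∀ j → 0ℤ ℤ.- t j ≡ index j) × Strict s index × s (fromℕ m) ≡ suc (suc m)
    fano s↗ s≤1+s (_ , _ , lattice⇔0) = Strict-unique {s = s} s↗ s≤1+s (λ j → 0ℤ ℤ.- t j)
      (interior⇒Strict (λ j → 0ℤ ℤ.- t j) (interior-- (λ _ → 0ℤ) (Equivalence.from (lattice⇔0 (λ _ → 0ℤ)) λ _ → ≡.refl)))
      (λ w w-strict j → ≡.trans (ℤ.i-j≡0⇒i≡j (w j) (ℤ.- t j) (≡.trans (≡.cong (λ a → w j ℤ.+ a) (ℤ.neg-involutive (t j)))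
          (Equivalence.to (lattice⇔0 (λ j → w j ℤ.+ t j)) (interior-+ w (Strict⇒interior s↗ w w-strict)) j)))
        (≡.sym (ℤ.+-identityˡ (ℤ.- t j))))

    module Centre (s↗ : ∀ i → s (inject₁ i) ℕ.≤ s (suc i)) (s≤1+s : ∀ i → s (suc i) ℕ.≤ suc (s (inject₁ i)))
                  (Q-fano : IsFano Q) where

      index-strict : Strict s index
      index-strict = proj₁ (proj₂ (fano s↗ s≤1+s Q-fano))

      s-last : s (fromℕ m) ≡ suc (suc m)
      s-last = proj₂ (proj₂ (fano s↗ s≤1+s Q-fano))

      x-t≈x+index : ∀ (x : Point (suc m)) j → x j - fromℤᴷ (t j) ≈ x j + fromℤᴷ (index j)
      x-t≈x+index x j = +-congˡ (trans (sym (fromℤᴷ-neg (t j)))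
        (reflexive (≡.cong fromℤᴷ (≡.trans (≡.sym (ℤ.+-identityˡ (ℤ.- t j))) (proj₁ (fano s↗ s≤1+s Q-fano) j)))))

      Q⇒centredHall : ∀ x → x ∈ Q → (λ j → x j + fromℤᴷ (index j)) ∈ Hall
      Q⇒centredHall x x∈Q =
        Hall-resp-≈ (λ j → x j - fromℤᴷ (t j)) (λ j → x j + fromℤᴷ (index j)) (x-t≈x+index x) (Q⇒Hall x x∈Q)

      centredHall⇒Q : ∀ x → (λ j → x j + fromℤᴷ (index j)) ∈ Hall → x ∈ Q
      centredHall⇒Q x x∈Hall =
        Hall⇒Q x (Hall-resp-≈ (λ j → x j + fromℤᴷ (index j)) (λ j → x j - fromℤᴷ (t j)) (sym ∘ x-t≈x+index x) x∈Hall)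

  -- Facets of the polytope centred at (1,...,d).

  module CentredHall
    (index-strict : Strict s index)
    {Q : Pred (Point (suc m)) ℓ₃}
    (Q⇒Hall : ∀ x → x ∈ Q → (λ j → x j + fromℤᴷ (index j)) ∈ Hall)
    (Hall⇒Q : ∀ x → (λ j → x j + fromℤᴷ (index j)) ∈ Hall → x ∈ Q)
    where

    T : Fin (suc m) → Carrier
    T j = fromℤᴷ (index j)

    κ : Fin m → Carrier
    κ i = fromℤᴷ (k s i)

    -- Identifies kᵢ as the slack of the i-th facet at (1,...,d). It is positive since that point is
    -- strict, and after centring it becomes the right-hand side of the facet inequality.
    k≡ : ∀ i → k s i ≡ + s (inject₁ i) ℤ.* index (suc i) ℤ.- + s (suc i) ℤ.* index (inject₁ i)
    k≡ i = ≡.cong₂ ℤ._-_ (ℤ.*-comm (index (suc i)) (+ s (inject₁ i)))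
      (≡.trans (ℤ.*-comm (+ suc (toℕ i)) (+ s (suc i)))
        (≡.cong (λ a → + s (suc i) ℤ.* + suc a) (≡.sym (Fin.toℕ-inject₁ i))))

    κ≈ : ∀ i → κ i ≈ S (inject₁ i) * T (suc i) - S (suc i) * T (inject₁ i)
    κ≈ i = trans (reflexive (≡.cong fromℤᴷ (k≡ i)))
      (trans (fromℤᴷ-- (+ s (inject₁ i) ℤ.* index (suc i)) (+ s (suc i) ℤ.* index (inject₁ i)))
        (+-cong (fromℤᴷ-* (+ s (inject₁ i)) (index (suc i))) (-‿cong (fromℤᴷ-* (+ s (suc i)) (index (inject₁ i))))))

    0<κ : ∀ i → 0# < κ i
    0<κ i = fromℤᴷ-mono-< (≡.subst (0ℤ ℤ.<_) (≡.sym (k≡ i))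
      (≡.subst (ℤ._< + s (inject₁ i) ℤ.* index (suc i) ℤ.- + s (suc i) ℤ.* index (inject₁ i))
        (ℤ.+-inverseʳ (+ s (suc i) ℤ.* index (inject₁ i)))
        (ℤ.+-monoˡ-< (ℤ.- (+ s (suc i) ℤ.* index (inject₁ i))) (proj₁ (proj₂ index-strict) i))))

    T≤S : T (fromℕ m) ≤ S (fromℕ m)
    T≤S = <⇒≤ (fromℤᴷ-mono-< (proj₂ (proj₂ index-strict)))

    0≤T : 0# ≤ T zero
    0≤T = 0≤fromℕᴷ 1

    slope≤κ : ∀ {x} → x ∈ Q → ∀ i → S (suc i) * x (inject₁ i) - S (inject₁ i) * x (suc i) ≤ κ i
    slope≤κ {x} x∈Q i = 0≤⇒≤ (x≤y⇒0≤y-x (proj₁ (proj₂ (Q⇒Hall x x∈Q)) i))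
      (trans (solve 6 (λ a b x y u v → a :* (y :+ v) :- b :* (x :+ u) := (a :* v :- b :* u) :- (b :* x :- a :* y)) refl
          (S (inject₁ i)) (S (suc i)) (x (inject₁ i)) (x (suc i)) (T (inject₁ i)) (T (suc i)))
        (+-congʳ (sym (κ≈ i))))

    slope≤κ⇒∈Q : ∀ x → 0# ≤ x zero + T zero →
                 (∀ i → S (suc i) * x (inject₁ i) - S (inject₁ i) * x (suc i) ≤ κ i) →
                 x (fromℕ m) + T (fromℕ m) ≤ S (fromℕ m) → x ∈ Q
    slope≤κ⇒∈Q x 0≤ slope ≤S = Hall⇒Q x (0≤ ,
      (λ i → 0≤⇒≤ (x≤y⇒0≤y-x (slope i))
        (trans (+-congʳ (κ≈ i))
          (solve 6 (λ a b x y u v → (a :* v :- b :* u) :- (b :* x :- a :* y) := a :* (y :+ v) :- b :* (x :+ u)) refl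
            (S (inject₁ i)) (S (suc i)) (x (inject₁ i)) (x (suc i)) (T (inject₁ i)) (T (suc i))))) ,
      ≤S)

    -- Extreme coordinates over the dual, and divisibility.

    axis : Fin (suc m) → Carrier → Point (suc m)
    axis l e j = fromℤᴷ (δ l j) * e

    ⟨axis,⟩ : ∀ l e y → ⟨ axis l e , y ⟩ ≈ e * y l
    ⟨axis,⟩ l e y = trans (sum-cong-≋ (λ j → *-assoc (fromℤᴷ (δ l j)) e (y j))) (sum-δ l (λ j → e * y j))

    0≤δ* : ∀ (l j : Fin (suc m)) {e} → 0# ≤ e → 0# ≤ fromℤᴷ (δ l j) * e
    0≤δ* l j = 0≤-* (fromℤᴷ-0≤ (δ-nonNegative l j))

    δ*≤ : ∀ {n} (i i′ : Fin n) {e b : Carrier} → (i ≡ i′ → e ≤ b) → 0# ≤ b → fromℤᴷ (δ i i′) * e ≤ b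
    δ*≤ i i′ e≤b 0≤b with ≡-or-δ≡0 i i′
    ... | inj₂ δ≡0    = ≤-resp-≈ (sym (trans (*-congʳ (reflexive (≡.cong fromℤᴷ δ≡0))) (zeroˡ _))) refl 0≤b
    ... | inj₁ i≡i′@≡.refl = ≤-resp-≈
      (sym (trans (*-congʳ (trans (reflexive (≡.cong fromℤᴷ (δ-diagonal i))) fromℤᴷ-1)) (*-identityˡ _))) refl (e≤b ≡.refl)

    -- Pairing with these points of the i-th facet bounds the i-th and (i+1)-st
    -- coordinates on the dual.
    axis-inject₁∈Q : ∀ i → axis (inject₁ i) (κ i * R (suc i)) ∈ Q
    axis-inject₁∈Q i = slope≤κ⇒∈Q _ (0≤-+ (0≤δ* (inject₁ i) zero 0≤e) 0≤T)
      -- Against facet i′ the coordinate `inject₁ i′` contributes kᵢ if i′ = i and 0 otherwise,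
      -- while the coordinate `suc i′` is nonnegative and enters with a minus sign.
      (λ i′ → ≤-trans
        (0≤⇒≤ (0≤-* (0≤S (inject₁ i′)) (0≤δ* (inject₁ i) (suc i′) 0≤e))
          (trans (solve 4 (λ a b x y → a :* y := b :* x :- (b :* x :- a :* y)) refl (S (inject₁ i′)) (S (suc i′)) (axis (inject₁ i) e (inject₁ i′)) (axis (inject₁ i) e (suc i′)))
          (+-congʳ (trans (*-congˡ (*-congʳ (reflexive (≡.cong fromℤᴷ (δ-inject₁ i i′)))))
            (solve 3 (λ b d e → b :* (d :* e) := d :* (b :* e)) refl (S (suc i′)) (fromℤᴷ (δ i i′)) e)))))
        (δ*≤ i i′ (λ {≡.refl → ≈⇒≤ (trans (solve 3 (λ a k r → a :* (k :* r) := k :* (a :* r)) refl (S (suc i)) (κ i) (R (suc i))) (cancel-SR (suc i) (κ i)))}) (<⇒≤ (0<κ i′))))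
      (≤-resp-≈ (sym (trans (+-congʳ (trans (*-congʳ (reflexive (≡.cong fromℤᴷ (≡.trans (δ-sym (inject₁ i) (fromℕ m)) (δ-fromℕ-inject₁ i))))) (zeroˡ e))) (+-identityˡ _))) refl T≤S)
      where
      e = κ i * R (suc i)
      0≤e : 0# ≤ e
      0≤e = 0≤-* (<⇒≤ (0<κ i)) (0≤R (suc i))

    axis-suc∈Q : ∀ i → axis (suc i) (- (κ i * R (inject₁ i))) ∈ Q
    axis-suc∈Q i = slope≤κ⇒∈Q _ (≤-resp-≈ refl (sym (trans (+-congʳ (zeroˡ (- e))) (+-identityˡ _))) 0≤T)
      (λ i′ → ≤-trans
        (0≤⇒≤ (0≤-* (0≤S (suc i′)) (0≤δ* (suc i) (inject₁ i′) 0≤e))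
          (solve 5 (λ a b x y e → b :* (x :* e) := y :* (a :* e) :- (b :* (x :* (:- e)) :- a :* (y :* (:- e)))) refl
            (S (inject₁ i′)) (S (suc i′)) (fromℤᴷ (δ (suc i) (inject₁ i′))) (fromℤᴷ (δ i i′)) e))
        (δ*≤ i i′ (λ {≡.refl → ≈⇒≤ (trans (solve 3 (λ a k r → a :* (k :* r) := k :* (a :* r)) refl (S (inject₁ i)) (κ i) (R (inject₁ i))) (cancel-SR (inject₁ i) (κ i)))}) (<⇒≤ (0<κ i′))))
      (≤-trans (0≤⇒≤ (0≤δ* (suc i) (fromℕ m) 0≤e)
        (solve 3 (λ d e t → d :* e := t :- (d :* (:- e) :+ t)) refl (fromℤᴷ (δ (suc i) (fromℕ m))) e (T (fromℕ m)))) T≤S)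
      where
      e = κ i * R (inject₁ i)
      0≤e : 0# ≤ e
      0≤e = 0≤-* (<⇒≤ (0<κ i)) (0≤R (inject₁ i))

    module FacetNormal (i : Fin m) where

      κ⁻¹ = proj₁ (0<⇒invertible (0<κ i))

      0<κ⁻¹ : 0# < κ⁻¹
      0<κ⁻¹ = proj₁ (proj₂ (0<⇒invertible (0<κ i)))

      κκ⁻¹≈1 : κ i * κ⁻¹ ≈ 1#
      κκ⁻¹≈1 = proj₂ (proj₂ (0<⇒invertible (0<κ i)))

      -- Taken over the field, as the integrality of this vector is the point at issue.
      normal : Point (suc m)
      normal j = fromℤᴷ (δ (inject₁ i) j) * (S (suc i) * κ⁻¹) + fromℤᴷ (δ (suc i) j) * (- (S (inject₁ i) * κ⁻¹))

      normal∈Dual : normal ∈ Dual Q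
      normal∈Dual x x∈Q = ≤-resp-≈ (sym pairing) (trans (*-comm κ⁻¹ (κ i)) κκ⁻¹≈1) (*-monoʳ-≤ (<⇒≤ 0<κ⁻¹) (slope≤κ x∈Q i))
        where
        open ≈-Reasoning setoid
        pairing : ⟨ x , normal ⟩ ≈ κ⁻¹ * (S (suc i) * x (inject₁ i) - S (inject₁ i) * x (suc i))
        pairing = begin
          sum (λ j → x j * normal j)
            ≈⟨ sum-cong-≋ (λ j → solve 5 (λ x d d′ a b → x :* (d :* a :+ d′ :* b) := d :* (x :* a) :+ d′ :* (x :* b)) refl
                 (x j) (fromℤᴷ (δ (inject₁ i) j)) (fromℤᴷ (δ (suc i) j)) (S (suc i) * κ⁻¹) (- (S (inject₁ i) * κ⁻¹))) ⟩
          sum (λ j → fromℤᴷ (δ (inject₁ i) j) * (x j * (S (suc i) * κ⁻¹)) + fromℤᴷ (δ (suc i) j) * (x j * (- (S (inject₁ i) * κ⁻¹))))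
            ≈⟨ ∑-distrib-+ (λ j → fromℤᴷ (δ (inject₁ i) j) * (x j * (S (suc i) * κ⁻¹))) (λ j → fromℤᴷ (δ (suc i) j) * (x j * (- (S (inject₁ i) * κ⁻¹)))) ⟩
          sum (λ j → fromℤᴷ (δ (inject₁ i) j) * (x j * (S (suc i) * κ⁻¹))) + sum (λ j → fromℤᴷ (δ (suc i) j) * (x j * (- (S (inject₁ i) * κ⁻¹))))
            ≈⟨ +-cong (sum-δ (inject₁ i) (λ j → x j * (S (suc i) * κ⁻¹))) (sum-δ (suc i) (λ j → x j * (- (S (inject₁ i) * κ⁻¹)))) ⟩
          x (inject₁ i) * (S (suc i) * κ⁻¹) + x (suc i) * (- (S (inject₁ i) * κ⁻¹))
            ≈⟨ solve 5 (λ x y a b r → x :* (b :* r) :+ y :* (:- (a :* r)) := r :* (b :* x :- a :* y)) refl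
                 (x (inject₁ i)) (x (suc i)) (S (inject₁ i)) (S (suc i)) κ⁻¹ ⟩
          κ⁻¹ * (S (suc i) * x (inject₁ i) - S (inject₁ i) * x (suc i)) ∎

      normal-inject₁ : κ i * normal (inject₁ i) ≈ S (suc i)
      normal-inject₁ = begin
        κ i * normal (inject₁ i)
          ≡⟨ ≡.cong₂ (λ d d′ → κ i * (fromℤᴷ d * (S (suc i) * κ⁻¹) + fromℤᴷ d′ * (- (S (inject₁ i) * κ⁻¹))))
               (δ-diagonal (inject₁ i)) (≡.trans (δ-sym (suc i) (inject₁ i)) (δ-inject₁-suc i)) ⟩
        κ i * (fromℤᴷ 1ℤ * (S (suc i) * κ⁻¹) + fromℤᴷ 0ℤ * (- (S (inject₁ i) * κ⁻¹)))
          ≈⟨ solve 4 (λ k r b c → k :* (con 1ℤ :* (b :* r) :+ con 0ℤ :* c) := b :* (k :* r)) refl (κ i) κ⁻¹ (S (suc i)) (- (S (inject₁ i) * κ⁻¹)) ⟩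
        S (suc i) * (κ i * κ⁻¹)   ≈⟨ trans (*-congˡ κκ⁻¹≈1) (*-identityʳ _) ⟩
        S (suc i)                 ∎
        where open ≈-Reasoning setoid

      -- The sign is put on kᵢ so that the minimum of this coordinate is handled as a maximum, the
      -- form that `average-divides` takes.
      normal-suc : (- κ i) * normal (suc i) ≈ S (inject₁ i)
      normal-suc = begin
        (- κ i) * normal (suc i)
          ≡⟨ ≡.cong₂ (λ d d′ → (- κ i) * (fromℤᴷ d * (S (suc i) * κ⁻¹) + fromℤᴷ d′ * (- (S (inject₁ i) * κ⁻¹))))
               (δ-inject₁-suc i) (δ-diagonal (suc i)) ⟩
        (- κ i) * (fromℤᴷ 0ℤ * (S (suc i) * κ⁻¹) + fromℤᴷ 1ℤ * (- (S (inject₁ i) * κ⁻¹)))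
          ≈⟨ solve 4 (λ k r b c → (:- k) :* (con 0ℤ :* c :+ con 1ℤ :* (:- (b :* r))) := b :* (k :* r)) refl (κ i) κ⁻¹ (S (inject₁ i)) (S (suc i) * κ⁻¹) ⟩
        S (inject₁ i) * (κ i * κ⁻¹)   ≈⟨ trans (*-congˡ κκ⁻¹≈1) (*-identityʳ _) ⟩
        S (inject₁ i)                 ∎
        where open ≈-Reasoning setoid

    -- `normal` need not be among the generators `v`; it is only an average of them. The axis points
    -- bound the relevant coordinate of every generator, and the average attains the bound, which
    -- suffices for divisibility.
    dual-lattice⇒divides : IsLatticePolytope (Dual Q) → ∀ i → k s i ∣ + s (inject₁ i) × k s i ∣ + s (suc i)
    dual-lattice⇒divides (n , v , Dual⊆hull , hull⊆Dual) i =
      flip-sign (average-divides μ (λ a → v a (suc i)) (ℤ.- k s i) (+ s (inject₁ i)) 0≤μ Σμ≈1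
        (λ a → fromℤᴷ-cancel-≤ (≤-resp-≈
          (begin
            S (inject₁ i) * ⟨ axis (suc i) (- (κ i * R (inject₁ i))) , latticePoint (v a) ⟩
              ≈⟨ *-congˡ (⟨axis,⟩ (suc i) (- (κ i * R (inject₁ i))) (latticePoint (v a))) ⟩
            S (inject₁ i) * (- (κ i * R (inject₁ i)) * fromℤᴷ (v a (suc i)))
              ≈⟨ solve 4 (λ a k r v → a :* (:- (k :* r) :* v) := (:- k) :* v :* (a :* r)) refl (S (inject₁ i)) (κ i) (R (inject₁ i)) (fromℤᴷ (v a (suc i))) ⟩
            (- κ i) * fromℤᴷ (v a (suc i)) * (S (inject₁ i) * R (inject₁ i))
              ≈⟨ cancel-SR (inject₁ i) _ ⟩
            (- κ i) * fromℤᴷ (v a (suc i))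
              ≈⟨ *-congʳ (fromℤᴷ-neg (k s i)) ⟨
            fromℤᴷ (ℤ.- k s i) * fromℤᴷ (v a (suc i))
              ≈⟨ fromℤᴷ-* (ℤ.- k s i) (v a (suc i)) ⟨
            fromℤᴷ (ℤ.- k s i ℤ.* v a (suc i)) ∎)
          (*-identityʳ _) (*-monoʳ-≤ (0≤S (inject₁ i)) (hull⊆Dual (lattice-vertex∈hull v a) _ (axis-suc∈Q i)))))
        (trans (*-cong (fromℤᴷ-neg (k s i)) (sym (normal≈ (suc i)))) normal-suc)) ,
      average-divides μ (λ a → v a (inject₁ i)) (k s i) (+ s (suc i)) 0≤μ Σμ≈1
        (λ a → fromℤᴷ-cancel-≤ (≤-resp-≈
          (begin
            S (suc i) * ⟨ axis (inject₁ i) (κ i * R (suc i)) , latticePoint (v a) ⟩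
              ≈⟨ *-congˡ (⟨axis,⟩ (inject₁ i) (κ i * R (suc i)) (latticePoint (v a))) ⟩
            S (suc i) * (κ i * R (suc i) * fromℤᴷ (v a (inject₁ i)))
              ≈⟨ solve 4 (λ a k r v → a :* (k :* r :* v) := k :* v :* (a :* r)) refl (S (suc i)) (κ i) (R (suc i)) (fromℤᴷ (v a (inject₁ i))) ⟩
            κ i * fromℤᴷ (v a (inject₁ i)) * (S (suc i) * R (suc i))
              ≈⟨ cancel-SR (suc i) _ ⟩
            κ i * fromℤᴷ (v a (inject₁ i))
              ≈⟨ fromℤᴷ-* (k s i) (v a (inject₁ i)) ⟨
            fromℤᴷ (k s i ℤ.* v a (inject₁ i)) ∎)
          (*-identityʳ _) (*-monoʳ-≤ (0≤S (suc i)) (hull⊆Dual (lattice-vertex∈hull v a) _ (axis-inject₁∈Q i)))))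
        (trans (*-congˡ (sym (normal≈ (inject₁ i)))) normal-inject₁)
      where
      open FacetNormal i
      open ≈-Reasoning setoid
      normal∈hull : normal ∈ ConvexHull (latticePoint ∘ v)
      normal∈hull = Dual⊆hull normal∈Dual
      μ = proj₁ normal∈hull
      0≤μ = proj₁ (proj₂ normal∈hull)
      Σμ≈1 = proj₁ (proj₂ (proj₂ normal∈hull))
      normal≈ = proj₂ (proj₂ (proj₂ normal∈hull))
      flip-sign : ∀ {a b} → ℤ.- a ∣ b → a ∣ b
      flip-sign {a} (divides q b≡q*-a) = divides (ℤ.- q) (≡.trans b≡q*-a
        (≡.trans (≡.sym (ℤ.neg-distribʳ-* q a)) (ℤ.neg-distribˡ-* q a)))

    -- The dual as the hull of integral facet normals.

    module DualVertices (s-last : s (fromℕ m) ≡ suc (suc m)) (p₀ q₀ : Vector ℤ m)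
      (p₀k≡s : ∀ i → + s (suc i) ≡ p₀ i ℤ.* k s i)
      (q₀k≡s : ∀ i → + s (inject₁ i) ≡ q₀ i ℤ.* k s i) where

      -- The positive and the negated negative entries of the normals: sᵢ₊₁/kᵢ and sᵢ/kᵢ from uᵢ,
      -- the last 1 of `p` from e_d and the first 1 of `q` from -e₁.
      p q : Vector ℤ (suc m)
      p = p₀ ∷ʳ 1ℤ
      q = 1ℤ ∷ q₀

      P : Fin (suc m) → Carrier
      P j = fromℤᴷ (p j)

      q₀ᴷ : Fin m → Carrier
      q₀ᴷ i = fromℤᴷ (q₀ i)

      -- The facet of f = suc j, respectively f = inject₁ j, bounds the j-th
      -- coordinate from above, respectively from below.
      facetNormal : Fin (suc (suc m)) → Vector ℤ (suc m)
      facetNormal f j = δ f (suc j) ℤ.* p j ℤ.- δ f (inject₁ j) ℤ.* q j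

      facetNormalᴷ : ∀ f j → fromℤᴷ (facetNormal f j) ≈ fromℤᴷ (δ f (suc j)) * P j - fromℤᴷ (δ f (inject₁ j)) * fromℤᴷ (q j)
      facetNormalᴷ f j = trans (fromℤᴷ-- (δ f (suc j) ℤ.* p j) (δ f (inject₁ j) ℤ.* q j))
        (+-cong (fromℤᴷ-* (δ f (suc j)) (p j)) (-‿cong (fromℤᴷ-* (δ f (inject₁ j)) (q j))))

      Pκ≈S : ∀ i → P (inject₁ i) * κ i ≈ S (suc i)
      Pκ≈S i = trans (*-congʳ (reflexive (≡.cong fromℤᴷ (∷ʳ-inject₁ p₀ 1ℤ i))))
        (trans (sym (fromℤᴷ-* (p₀ i) (k s i))) (reflexive (≡.cong fromℤᴷ (≡.sym (p₀k≡s i)))))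

      qκ≈S : ∀ i → q₀ᴷ i * κ i ≈ S (inject₁ i)
      qκ≈S i = trans (sym (fromℤᴷ-* (q₀ i) (k s i))) (reflexive (≡.cong fromℤᴷ (≡.sym (q₀k≡s i))))

      P-last : P (fromℕ m) ≈ 1#
      P-last = trans (reflexive (≡.cong fromℤᴷ (∷ʳ-fromℕ p₀ 1ℤ))) fromℤᴷ-1

      -- The last facet has slack exactly 1 at (1,...,d), just like 0 ≤ x₁; hence the normals of
      -- these two facets are integral without any divisibility.
      S-last : S (fromℕ m) ≈ 1# + T (fromℕ m)
      S-last = trans (reflexive (≡.cong fromℕᴷ s-last)) (reflexive (≡.cong (λ a → fromℕᴷ (suc (suc a))) (≡.sym (Fin.toℕ-fromℕ m))))

      pairing : ∀ (x : Point (suc m)) f → ⟨ x , latticePoint (facetNormal f) ⟩ ≈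
                sum (λ j → fromℤᴷ (δ f (suc j)) * (x j * P j)) - sum (λ j → fromℤᴷ (δ f (inject₁ j)) * (x j * fromℤᴷ (q j)))
      pairing x f = begin
        sum (λ j → x j * fromℤᴷ (facetNormal f j))
          ≈⟨ solve 2 (λ a b → a := (a :+ b) :- b) refl _ B′ ⟩
        (sum (λ j → x j * fromℤᴷ (facetNormal f j)) + B′) - B′
          ≈⟨ +-congʳ (∑-distrib-+ (λ j → x j * fromℤᴷ (facetNormal f j)) (λ j → fromℤᴷ (δ f (inject₁ j)) * (x j * fromℤᴷ (q j)))) ⟨
        sum (λ j → x j * fromℤᴷ (facetNormal f j) + fromℤᴷ (δ f (inject₁ j)) * (x j * fromℤᴷ (q j))) - B′
          ≈⟨ +-congʳ (sum-cong-≋ (λ j → trans (+-congʳ (*-congˡ (facetNormalᴷ f j)))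
               (solve 5 (λ x d p e q → x :* (d :* p :- e :* q) :+ e :* (x :* q) := d :* (x :* p)) refl
                 (x j) (fromℤᴷ (δ f (suc j))) (P j) (fromℤᴷ (δ f (inject₁ j))) (fromℤᴷ (q j))))) ⟩
        sum (λ j → fromℤᴷ (δ f (suc j)) * (x j * P j)) - B′ ∎
        where
        open ≈-Reasoning setoid
        B′ = sum (λ j → fromℤᴷ (δ f (inject₁ j)) * (x j * fromℤᴷ (q j)))

      sum-δ-inject₁ : ∀ i (x : Fin (suc m) → Carrier) → sum (λ j → fromℤᴷ (δ (inject₁ i) (inject₁ j)) * x j) ≈ x i
      sum-δ-inject₁ i x = trans (sum-cong-≋ (λ j → *-congʳ {x j} (reflexive (≡.cong fromℤᴷ (δ-inject₁ i j))))) (sum-δ i x)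

      -- The number 1 - ⟨x , u⟩ is the slack of the facet at x + (1,...,d) over its slack at
      -- (1,...,d), the latter being 1 for the two outer facets and kᵢ for the middle ones.
      facetNormal∈Dual : ∀ f → latticePoint (facetNormal f) ∈ Dual Q
      facetNormal∈Dual zero x x∈Q = 0≤⇒≤ (proj₁ (Q⇒Hall x x∈Q)) (begin
        x zero + T zero
          ≈⟨ +-congˡ fromℤᴷ-1 ⟩
        x zero + 1#
          ≈⟨ solve 2 (λ x o → x :+ o := o :- (con 0ℤ :- x :* con 1ℤ)) refl (x zero) 1# ⟩
        1# - (0# - x zero * fromℤᴷ 1ℤ)
          ≈⟨ +-congˡ (-‿cong (+-cong (sum-0 (λ j → zeroˡ (x j * P j))) (-‿cong (sum-δ-inject₁ zero (λ j → x j * fromℤᴷ (q j)))))) ⟨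
        1# - (sum (λ j → fromℤᴷ (δ (zero {suc m}) (suc j)) * (x j * P j)) - sum (λ j → fromℤᴷ (δ (zero {suc m}) (inject₁ j)) * (x j * fromℤᴷ (q j))))
          ≈⟨ +-congˡ (-‿cong (pairing x zero)) ⟨
        1# - ⟨ x , latticePoint (facetNormal zero) ⟩ ∎)
        where open ≈-Reasoning setoid
      facetNormal∈Dual (suc j) x x∈Q with view j
      ... | ‵fromℕ = 0≤⇒≤ (x≤y⇒0≤y-x (proj₂ (proj₂ (Q⇒Hall x x∈Q)))) (begin
        S (fromℕ m) - (x (fromℕ m) + T (fromℕ m))
          ≈⟨ +-congʳ S-last ⟩
        1# + T (fromℕ m) - (x (fromℕ m) + T (fromℕ m))
          ≈⟨ solve 3 (λ o t x → o :+ t :- (x :+ t) := o :- (x :- con 0ℤ)) refl 1# (T (fromℕ m)) (x (fromℕ m)) ⟩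
        1# - (x (fromℕ m) - 0#)
          ≈⟨ +-congˡ (-‿cong (+-cong (trans (sum-δ (fromℕ m) (λ j → x j * P j)) (trans (*-congˡ P-last) (*-identityʳ _)))
               (-‿cong (sum-0 (λ j → trans (*-congʳ (reflexive (≡.cong fromℤᴷ (δ-fromℕ-inject₁ j)))) (zeroˡ (x j * fromℤᴷ (q j)))))))) ⟨
        1# - (sum (λ j → fromℤᴷ (δ (fromℕ m) j) * (x j * P j)) - sum (λ j → fromℤᴷ (δ (fromℕ (suc m)) (inject₁ j)) * (x j * fromℤᴷ (q j))))
          ≈⟨ +-congˡ (-‿cong (pairing x (fromℕ (suc m)))) ⟨
        1# - ⟨ x , latticePoint (facetNormal (fromℕ (suc m))) ⟩ ∎)
        where open ≈-Reasoning setoid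
      ... | ‵inject₁ i = ≤-resp-≈
        (begin
          κ⁻¹ * (S (suc i) * x (inject₁ i) - S (inject₁ i) * x (suc i))
            ≈⟨ *-congˡ (+-cong (*-congʳ (Pκ≈S i)) (-‿cong (*-congʳ (qκ≈S i)))) ⟨
          κ⁻¹ * (P (inject₁ i) * κ i * x (inject₁ i) - q₀ᴷ i * κ i * x (suc i))
            ≈⟨ solve 6 (λ r k p q x y → r :* (p :* k :* x :- q :* k :* y) := (x :* p :- y :* q) :* (k :* r)) refl
                 κ⁻¹ (κ i) (P (inject₁ i)) (q₀ᴷ i) (x (inject₁ i)) (x (suc i)) ⟩
          (x (inject₁ i) * P (inject₁ i) - x (suc i) * q₀ᴷ i) * (κ i * κ⁻¹)
            ≈⟨ trans (*-congˡ κκ⁻¹≈1) (*-identityʳ _) ⟩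
          x (inject₁ i) * P (inject₁ i) - x (suc i) * q₀ᴷ i
            ≈⟨ +-cong (sum-δ (inject₁ i) (λ j → x j * P j)) (-‿cong (sum-δ-inject₁ (suc i) (λ j → x j * fromℤᴷ (q j)))) ⟨
          sum (λ j → fromℤᴷ (δ (inject₁ i) j) * (x j * P j)) - sum (λ j → fromℤᴷ (δ (inject₁ (suc i)) (inject₁ j)) * (x j * fromℤᴷ (q j)))
            ≈⟨ pairing x (suc (inject₁ i)) ⟨
          ⟨ x , latticePoint (facetNormal (suc (inject₁ i))) ⟩ ∎)
        (trans (*-comm κ⁻¹ (κ i)) κκ⁻¹≈1)
        (*-monoʳ-≤ (<⇒≤ 0<κ⁻¹) (slope≤κ x∈Q i))
        where
        open ≈-Reasoning setoid
        open FacetNormal i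

      hull⊆Dual : ∀ {y} → y ∈ ConvexHull (latticePoint ∘ facetNormal) → y ∈ Dual Q
      hull⊆Dual {y} (μ , 0≤μ , Σμ≈1 , y≈) x x∈Q = ≤-resp-≈
        (sym (⟨,⟩-combination (latticePoint ∘ facetNormal) μ x y y≈)) refl
        (average≤ μ (λ f → ⟨ x , latticePoint (facetNormal f) ⟩) 1# 0≤μ Σμ≈1 (λ f → facetNormal∈Dual f x x∈Q))

      ρ : Fin (suc m) → Carrier
      ρ j = T j * R j

      -- lo f and hi f are the ratios that the facet of f compares, at the point
      -- (1,…,d).
      hi lo gap : Fin (suc (suc m)) → Carrier
      hi = ρ ∷ʳ 1#
      lo = 0# ∷ ρ
      gap f = hi f - lo f

      gap-zero : gap zero ≈ R zero
      gap-zero = solve 1 (λ r → con 1ℤ :* r :- con 0ℤ := r) refl (R zero)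

      gap-suc-inject₁ : ∀ i → gap (suc (inject₁ i)) ≈ κ i * (R (inject₁ i) * R (suc i))
      gap-suc-inject₁ i = begin
        hi (inject₁ (suc i)) - ρ (inject₁ i)
          ≡⟨ ≡.cong (λ a → a - ρ (inject₁ i)) (∷ʳ-inject₁ ρ 1# (suc i)) ⟩
        T (suc i) * R (suc i) - T (inject₁ i) * R (inject₁ i)
          ≈⟨ +-cong (cancel-SR (inject₁ i) _) (-‿cong (cancel-SR (suc i) _)) ⟨
        T (suc i) * R (suc i) * (S (inject₁ i) * R (inject₁ i)) - T (inject₁ i) * R (inject₁ i) * (S (suc i) * R (suc i))
          ≈⟨ solve 6 (λ a b r t u v → v :* t :* (a :* r) :- u :* r :* (b :* t) := (a :* v :- b :* u) :* (r :* t)) refl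
               (S (inject₁ i)) (S (suc i)) (R (inject₁ i)) (R (suc i)) (T (inject₁ i)) (T (suc i)) ⟩
        (S (inject₁ i) * T (suc i) - S (suc i) * T (inject₁ i)) * (R (inject₁ i) * R (suc i))
          ≈⟨ *-congʳ (κ≈ i) ⟨
        κ i * (R (inject₁ i) * R (suc i)) ∎
        where open ≈-Reasoning setoid

      gap-last : gap (suc (fromℕ m)) ≈ R (fromℕ m)
      gap-last = begin
        hi (fromℕ (suc m)) - ρ (fromℕ m)
          ≡⟨ ≡.cong (λ a → a - ρ (fromℕ m)) (∷ʳ-fromℕ ρ 1#) ⟩
        1# - T (fromℕ m) * R (fromℕ m)
          ≈⟨ +-congʳ (trans (sym (SR≈1 (fromℕ m))) (trans (*-congʳ S-last) (trans (distribʳ _ _ _) (+-congʳ (*-identityˡ _))))) ⟩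
        R (fromℕ m) + T (fromℕ m) * R (fromℕ m) - T (fromℕ m) * R (fromℕ m)
          ≈⟨ solve 2 (λ r t → r :+ t :- t := r) refl (R (fromℕ m)) (T (fromℕ m) * R (fromℕ m)) ⟩
        R (fromℕ m) ∎
        where open ≈-Reasoning setoid

      0≤gap : ∀ f → 0# ≤ gap f
      0≤gap zero = ≤-resp-≈ refl (sym gap-zero) (0≤R zero)
      0≤gap (suc j) with view j
      ... | ‵fromℕ     = ≤-resp-≈ refl (sym gap-last) (0≤R (fromℕ m))
      ... | ‵inject₁ i = ≤-resp-≈ refl (sym (gap-suc-inject₁ i)) (0≤-* (<⇒≤ (0<κ i)) (0≤-* (0≤R (inject₁ i)) (0≤R (suc i))))

      -- Scaling a normal by its gap cancels kᵢ and leaves the coefficients of a difference of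
      -- consecutive ratios. Thus coordinate j gets the same weight 1/sⱼ, up to sign, from the two
      -- facets that involve it.
      gap-P : ∀ j → gap (suc j) * P j ≈ R j
      gap-P j with view j
      ... | ‵fromℕ     = trans (*-cong gap-last P-last) (*-identityʳ _)
      ... | ‵inject₁ i = begin
        gap (suc (inject₁ i)) * P (inject₁ i)                       ≈⟨ *-congʳ (gap-suc-inject₁ i) ⟩
        κ i * (R (inject₁ i) * R (suc i)) * P (inject₁ i)
          ≈⟨ solve 4 (λ k r t p → k :* (r :* t) :* p := r :* (p :* k :* t)) refl (κ i) (R (inject₁ i)) (R (suc i)) (P (inject₁ i)) ⟩
        R (inject₁ i) * (P (inject₁ i) * κ i * R (suc i))           ≈⟨ *-congˡ (*-congʳ (Pκ≈S i)) ⟩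
        R (inject₁ i) * (S (suc i) * R (suc i))                     ≈⟨ cancel-SR (suc i) _ ⟩
        R (inject₁ i)                                               ∎
        where open ≈-Reasoning setoid

      gap-q : ∀ j → gap (inject₁ j) * fromℤᴷ (q j) ≈ R j
      gap-q zero    = trans (*-cong gap-zero fromℤᴷ-1) (*-identityʳ _)
      gap-q (suc i) = begin
        gap (suc (inject₁ i)) * q₀ᴷ i                               ≈⟨ *-congʳ (gap-suc-inject₁ i) ⟩
        κ i * (R (inject₁ i) * R (suc i)) * q₀ᴷ i
          ≈⟨ solve 4 (λ k r t p → k :* (r :* t) :* p := t :* (p :* k :* r)) refl (κ i) (R (inject₁ i)) (R (suc i)) (q₀ᴷ i) ⟩
        R (suc i) * (q₀ᴷ i * κ i * R (inject₁ i))                   ≈⟨ *-congˡ (*-congʳ (qκ≈S i)) ⟩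
        R (suc i) * (S (inject₁ i) * R (inject₁ i))                 ≈⟨ cancel-SR (inject₁ i) _ ⟩
        R (suc i)                                                   ∎
        where open ≈-Reasoning setoid

      vertex : Fin (suc (suc m)) → Point (suc m)
      vertex f j = fromℤᴷ (χ f j) * S j

      vertex∈Hall : ∀ f → vertex f ∈ Hall
      vertex∈Hall f =
        0≤-* (fromℤᴷ-0≤ (0≤χ f zero)) (0≤S zero) ,
        (λ i → 0≤⇒≤ (0≤-* (0≤-* (0≤S (inject₁ i)) (0≤S (suc i))) (x≤y⇒0≤y-x (fromℤᴷ-mono-≤ (χ-mono f i))))
          (solve 4 (λ a b x y → a :* b :* (y :- x) := a :* (y :* b) :- b :* (x :* a)) refl
            (S (inject₁ i)) (S (suc i)) (fromℤᴷ (χ f (inject₁ i))) (fromℤᴷ (χ f (suc i))))) ,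
        0≤⇒≤ (0≤-* (0≤S (fromℕ m)) (x≤y⇒0≤y-x (fromℤᴷ-mono-≤ (χ≤1 f (fromℕ m)))))
          (solve 2 (λ a x → a :* (con 1ℤ :- x) := a :- x :* a) refl (S (fromℕ m)) (fromℤᴷ (χ f (fromℕ m))))

      -- Barycentric coordinates of a point of the dual.

      module Barycentric (y : Point (suc m)) (y∈Dual : y ∈ Dual Q) where

        D : Carrier
        D = sum (λ j → T j * y j)

        -- This is 1 - ⟨w , y⟩ for the vertex w = `vertex f` - (1,...,d) of `Q`; the translation is
        -- collected in `D`, which does not depend on `f`.
        a : Fin (suc (suc m)) → Carrier
        a f = 1# + D - ⟨ vertex f , y ⟩

        0≤a : ∀ f → 0# ≤ a f
        0≤a f = ≤-resp-≈ refl
          (begin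
            1# - ⟨ x , y ⟩
              ≈⟨ solve 3 (λ o b d → o :- b := o :+ d :- (b :+ d)) refl 1# ⟨ x , y ⟩ D ⟩
            1# + D - (⟨ x , y ⟩ + D)
              ≈⟨ +-congˡ (-‿cong (∑-distrib-+ (λ j → x j * y j) (λ j → T j * y j))) ⟨
            1# + D - sum (λ j → x j * y j + T j * y j)
              ≈⟨ +-congˡ (-‿cong (sum-cong-≋ (λ j → solve 3 (λ v t y → (v :- t) :* y :+ t :* y := v :* y) refl (vertex f j) (T j) (y j)))) ⟩
            a f ∎)
          (x≤y⇒0≤y-x (y∈Dual x (Hall⇒Q x (Hall-resp-≈ _ (λ j → x j + T j) (λ j → solve 2 (λ v t → v := v :- t :+ t) refl (vertex f j) (T j)) (vertex∈Hall f)))))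
          where
          open ≈-Reasoning setoid
          x : Point (suc m)
          x j = vertex f j - T j

        -- Consecutive vertices differ only in coordinate j, by sⱼ, so the values of `a` determine
        -- y.
        a-step : ∀ j → a (suc j) ≈ a (inject₁ j) + S j * y j
        a-step j = begin
          1# + D - ⟨ vertex (suc j) , y ⟩
            ≈⟨ solve 3 (λ e v w → e :- v := e :- (w :+ v) :+ w) refl (1# + D) ⟨ vertex (suc j) , y ⟩ (S j * y j) ⟩
          1# + D - (S j * y j + ⟨ vertex (suc j) , y ⟩) + S j * y j
            ≈⟨ +-congʳ (+-congˡ (-‿cong (+-congʳ (sum-δ j (λ l → S l * y l))))) ⟨
          1# + D - (sum (λ l → fromℤᴷ (δ j l) * (S l * y l)) + ⟨ vertex (suc j) , y ⟩) + S j * y j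
            ≈⟨ +-congʳ (+-congˡ (-‿cong (∑-distrib-+ (λ l → fromℤᴷ (δ j l) * (S l * y l)) (λ l → vertex (suc j) l * y l)))) ⟨
          1# + D - sum (λ l → fromℤᴷ (δ j l) * (S l * y l) + vertex (suc j) l * y l) + S j * y j
            ≈⟨ +-congʳ (+-congˡ (-‿cong (sum-cong-≋ (λ l → trans
                 (solve 4 (λ d s y x → d :* (s :* y) :+ x :* s :* y := (d :+ x) :* s :* y) refl (fromℤᴷ (δ j l)) (S l) (y l) (fromℤᴷ (χ (suc j) l)))
                 (*-congʳ (*-congʳ (trans (sym (fromℤᴷ-+ (δ j l) (χ (suc j) l))) (reflexive (≡.cong fromℤᴷ (≡.sym (χ-inject₁ j l)))))))))) ) ⟩
          a (inject₁ j) + S j * y j ∎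
          where open ≈-Reasoning setoid

        a-last : a (fromℕ (suc m)) ≈ 1# + D
        a-last = trans
          (+-congˡ (-‿cong (sum-0 λ j → trans (*-congʳ (trans (*-congʳ (reflexive (≡.cong fromℤᴷ (χ-fromℕ j)))) (zeroˡ (S j)))) (zeroˡ (y j)))))
          (solve 1 (λ e → e :- con 0ℤ := e) refl (1# + D))

        -- The vertex w of index f lies on every facet except that of f. Hence if y = Σ μ g u_g with
        -- Σ μ = 1, pairing with w leaves `a f` = μ f (1 - ⟨w , u_f⟩), and the last factor is the
        -- inverse of `gap f`. The gaps are also the barycentric coordinates of the origin in `Q`.
        μ : Fin (suc (suc m)) → Carrier
        μ f = gap f * a f

        0≤μ : ∀ f → 0# ≤ μ f
        0≤μ f = 0≤-* (0≤gap f) (0≤a f)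

        -- Summation by parts, as the values of hi and lo are ρ shifted by one.
        Σμ≈1 : sum μ ≈ 1#
        Σμ≈1 = begin
          sum μ                                  ≈⟨ solve 2 (λ u v → u := u :+ v :- v) refl (sum μ) (sum (λ f → lo f * a f)) ⟩
          sum μ + sum (λ f → lo f * a f) - sum (λ f → lo f * a f)
            ≈⟨ +-congʳ (∑-distrib-+ μ (λ f → lo f * a f)) ⟨
          sum (λ f → μ f + lo f * a f) - sum (λ f → lo f * a f)
            ≈⟨ +-cong (sum-cong-≋ (λ f → solve 3 (λ h l a → (h :- l) :* a :+ l :* a := h :* a) refl (hi f) (lo f) (a f))) (-‿cong Σlo) ⟩
          sum (λ f → hi f * a f) - (sum (λ j → ρ j * a (inject₁ j)) + D)
            ≈⟨ +-congʳ Σhi ⟩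
          sum (λ j → ρ j * a (inject₁ j)) + (1# + D) - (sum (λ j → ρ j * a (inject₁ j)) + D)
            ≈⟨ solve 3 (λ x o d → x :+ (o :+ d) :- (x :+ d) := o) refl (sum (λ j → ρ j * a (inject₁ j))) 1# D ⟩
          1# ∎
          where
          open ≈-Reasoning setoid
          Σhi : sum (λ f → hi f * a f) ≈ sum (λ j → ρ j * a (inject₁ j)) + (1# + D)
          Σhi = trans (sum-init-last (λ f → hi f * a f)) (+-cong
            (sum-cong-≋ (λ j → *-congʳ {a (inject₁ j)} (reflexive (∷ʳ-inject₁ ρ 1# j))))
            (trans (*-cong (reflexive (∷ʳ-fromℕ ρ 1#)) a-last) (*-identityˡ _)))
          Σlo : sum (λ f → lo f * a f) ≈ sum (λ j → ρ j * a (inject₁ j)) + D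
          Σlo = begin
            0# * a zero + sum (λ j → ρ j * a (suc j))      ≈⟨ trans (+-congʳ (zeroˡ _)) (+-identityˡ _) ⟩
            sum (λ j → ρ j * a (suc j))                    ≈⟨ sum-cong-≋ (λ j → trans (*-congˡ (a-step j))
              (trans (solve 5 (λ t r x s y → t :* r :* (x :+ s :* y) := t :* r :* x :+ t :* y :* (s :* r)) refl (T j) (R j) (a (inject₁ j)) (S j) (y j))
                (+-congˡ (cancel-SR j (T j * y j))))) ⟩
            sum (λ j → ρ j * a (inject₁ j) + T j * y j)    ≈⟨ ∑-distrib-+ (λ j → ρ j * a (inject₁ j)) (λ j → T j * y j) ⟩
            sum (λ j → ρ j * a (inject₁ j)) + D            ∎

        -- Only the normals of `suc j` and `inject₁ j` have a j-th entry. By `gap-P` and `gap-q`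
        -- their terms are `a (suc j)`/sⱼ and -`a (inject₁ j)`/sⱼ, which add up to yⱼ by `a-step`.
        combination : ∀ j → y j ≈ sum (λ f → μ f * fromℤᴷ (facetNormal f j))
        combination j = begin
          y j
            ≈⟨ cancel-SR j (y j) ⟨
          y j * (S j * R j)
            ≈⟨ solve 4 (λ y s r x → y :* (s :* r) := (x :+ s :* y) :* r :- x :* r) refl (y j) (S j) (R j) (a (inject₁ j)) ⟩
          (a (inject₁ j) + S j * y j) * R j - a (inject₁ j) * R j
            ≈⟨ +-cong (*-cong (a-step j) (gap-P j)) (-‿cong (*-congˡ (gap-q j))) ⟨
          a (suc j) * (gap (suc j) * P j) - a (inject₁ j) * (gap (inject₁ j) * Qj)
            ≈⟨ solve 6 (λ x g p w h q → x :* (g :* p) :- w :* (h :* q) := g :* x :* p :- h :* w :* q) refl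
                 (a (suc j)) (gap (suc j)) (P j) (a (inject₁ j)) (gap (inject₁ j)) Qj ⟩
          μ (suc j) * P j - μ (inject₁ j) * Qj
            ≈⟨ +-cong (sum-δ (suc j) (λ f → μ f * P j)) (-‿cong (sum-δ (inject₁ j) (λ f → μ f * Qj))) ⟨
          sum (λ f → fromℤᴷ (δ (suc j) f) * (μ f * P j)) - B′
            ≈⟨ +-congʳ (sum-cong-≋ (λ f → begin
                fromℤᴷ (δ (suc j) f) * (μ f * P j)
                  ≡⟨ ≡.cong (λ d → fromℤᴷ d * (μ f * P j)) (δ-sym (suc j) f) ⟩
                fromℤᴷ (δ f (suc j)) * (μ f * P j)
                  ≈⟨ solve 5 (λ d m p e q → d :* (m :* p) := m :* (d :* p :- e :* q) :+ e :* (m :* q)) refl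
                       (fromℤᴷ (δ f (suc j))) (μ f) (P j) (fromℤᴷ (δ f (inject₁ j))) Qj ⟩
                μ f * (fromℤᴷ (δ f (suc j)) * P j - fromℤᴷ (δ f (inject₁ j)) * Qj) + fromℤᴷ (δ f (inject₁ j)) * (μ f * Qj)
                  ≈⟨ +-cong (*-congˡ (facetNormalᴷ f j)) (*-congʳ (reflexive (≡.cong fromℤᴷ (δ-sym (inject₁ j) f)))) ⟨
                μ f * fromℤᴷ (facetNormal f j) + fromℤᴷ (δ (inject₁ j) f) * (μ f * Qj) ∎)) ⟩
          sum (λ f → μ f * fromℤᴷ (facetNormal f j) + fromℤᴷ (δ (inject₁ j) f) * (μ f * Qj)) - B′
            ≈⟨ +-congʳ (∑-distrib-+ (λ f → μ f * fromℤᴷ (facetNormal f j)) (λ f → fromℤᴷ (δ (inject₁ j) f) * (μ f * Qj))) ⟩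
          sum (λ f → μ f * fromℤᴷ (facetNormal f j)) + B′ - B′
            ≈⟨ solve 2 (λ u v → u :+ v :- v := u) refl _ B′ ⟩
          sum (λ f → μ f * fromℤᴷ (facetNormal f j)) ∎
          where
          open ≈-Reasoning setoid
          Qj = fromℤᴷ (q j)
          B′ = sum (λ f → fromℤᴷ (δ (inject₁ j) f) * (μ f * Qj))

      Dual≐hull : Dual Q ≐ ConvexHull (latticePoint ∘ facetNormal)
      Dual≐hull = (λ {y} y∈Dual → let open Barycentric y y∈Dual in μ , 0≤μ , Σμ≈1 , combination) , hull⊆Dual

theorem2p9 : ∀ {c ℓ₁ ℓ₂ ℓ₃} (K : OrderedField c ℓ₁ ℓ₂ ℓ₃) →
    let open Geometry K in
    ∀ (m : ℕ) (s : Vector ℕ (suc m)) (s≢0 : ∀ i → NonZero (s i)) →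
    (∀ (i : Fin m) → s (inject₁ i) ℕ.≤ s (suc i)) →
    (∀ (i : Fin m) → 0ℤ ℤ.≤ + s (suc i) ℤ.- + s (inject₁ i) ×
    + s (suc i) ℤ.- + s (inject₁ i) ℤ.≤ 1ℤ) →
    IsFanoUpToTranslation (LectureHall s s≢0) →
    IsReflexiveUpToTranslation (LectureHall s s≢0) ⇔
    (∀ (i : Fin m) → k s i ∣ + s (inject₁ i) × k s i ∣ + s (suc i))
theorem2p9 K m s s≢0 s↗ steps (Q , Q-fano , t , Q⇔P) = mk⇔ reflexive⇒divides divides⇒reflexive
  where
  open Geometry K
  open LectureHallProperties K s s≢0

  s≤1+s : ∀ i → s (suc i) ℕ.≤ suc (s (inject₁ i))
  s≤1+s i = ℤ.drop‿+≤+ (≡.subst (ℤ._≤ + suc (s (inject₁ i)))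
    (≡.trans (ℤ.+-assoc (+ s (suc i)) (ℤ.- + s (inject₁ i)) (+ s (inject₁ i)))
      (≡.trans (≡.cong (λ a → + s (suc i) ℤ.+ a) (ℤ.+-inverseˡ (+ s (inject₁ i)))) (ℤ.+-identityʳ (+ s (suc i)))))
    (ℤ.+-monoˡ-≤ (+ s (inject₁ i)) (proj₂ (steps i))))

  reflexive⇒divides : IsReflexiveUpToTranslation (LectureHall s s≢0) →
                      ∀ i → k s i ∣ + s (inject₁ i) × k s i ∣ + s (suc i)
  -- The reflexive translate is itself Fano, so it is centred at (1,...,d) by its own uniqueness and
  -- need not be compared with `Q`.
  reflexive⇒divides (_ , (Q′-fano , dual-lattice) , t′ , Q′⇔P) = dual-lattice⇒divides dual-lattice
    where
    open Translate t′ Q′⇔P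
    open Centre s↗ s≤1+s Q′-fano
    open CentredHall index-strict Q⇒centredHall centredHall⇒Q

  divides⇒reflexive : (∀ i → k s i ∣ + s (inject₁ i) × k s i ∣ + s (suc i)) →
                      IsReflexiveUpToTranslation (LectureHall s s≢0)
  -- The given Fano translate is the witness, so only the dual remains; its d + 1 generators are the
  -- normals of the facets of a d-simplex.
  divides⇒reflexive k∣s = Q , (Q-fano , suc (suc m) , facetNormal , Dual≐hull) , t , Q⇔P
    where
    open Translate t Q⇔P
    open Centre s↗ s≤1+s Q-fano
    open CentredHall index-strict Q⇒centredHall centredHall⇒Q
    open DualVertices s-last
      (λ i → _∣_.quotient (proj₂ (k∣s i))) (λ i → _∣_.quotient (proj₁ (k∣s i)))
      (λ i → _∣_.equality (proj₂ (k∣s i))) (λ i → _∣_.equality (proj₁ (k∣s i)))
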